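{- Let $\mathcal A$ be a class of function algebras. The class of provably total functions of the recursive arithmetic $\mathcal A\mathsf{RA}_1$ is exactly the class of functions $f\colon\mathbb N\times 2^{\mathbb N}\to\mathbb N$ for which there is a derivation $d$ in $\mathcal A$ such that for every $X\subseteq\mathbb N$ the standard model $(\mathbb N,X,\vec f)$ of $\mathcal A\mathsf{RA}_1$ satisfies $f_d(x)=f(x,X)$ for all $x\in\mathbb N$.
   Context: **Language $L_1$ and BASIC.** $L_1$ is the first-order language with constant $0$, unary function symbols $S,H,T$, binary function symbols $+,\cdot$, a binary pairing function symbol $(\cdot,\cdot)$, and a binary relation $<$. Write $1=S(0)$, $2=S(S(0))$, and $x\le y$ for $x<y\lor x=y$. Pairing associates to the right, and $f(x,y)$ means $f((x,y))$. BASIC consists of the universal closures of: $S(x)\neq 0$; $S(x)=S(y)\to x=y$; $x+0=x$; $x+S(y)=S(x+y)$; $x\cdot 0=0$; $x\cdot S(y)=x\cdot y+x$; $\lnot x<0$; $x<S(y)\leftrightarrow x<y\lor x=y$; $x<y\lor x=y\lor y<x$; $0<x\to\exists y<x\,S(y)=x$; $(x,y)=z\leftrightarrow 2\cdot z=(x+y)\cdot(x+y+1)+2\cdot x+2$; $(x,y)=(x',y')\to x=x'\land y=y'$; $z>0\to\exists x,y<z\,(x,y)=z$; $H((x,y))=x$; $H(0)=0$; $T((x,y))=y$; $T(0)=0$. $\mathbb N$ also denotes the standard $L_1$-structure satisfying BASIC. **Functions as sets.** $L_1(X,\vec f)$ is $L_1$ with additional unary predicate symbols ("set constants") $X$ and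 $f_d$ ($d$ a derivation, below); $t\in X$ is written for $X(t)$. For a set $f$, $f\in\mathcal F$ abbreviates $\forall x\exists y\,(x,y)\in f\land\forall x,y,y'((x,y)\in f\land(x,y')\in f\to y=y')\land 0\notin f$; $f(t)=s$ abbreviates $(t,s)\in f$. **Function operators and classes of algebras.** A function operator $f:=\mathrm{op}(g_1,\dots,g_n)$ ($n\ge 0$) is specified by a formula of $L_1$ extended with atomic formulas $t\in Y$ for set variables $Y$, with no free number variables and no set quantifiers, containing exactly the set variables $f,g_1,\dots,g_n$, and which is a universal sentence (the universal closure over number variables of a quantifier-free formula, with $g(t)=s$ read as $(t,s)\in g$). It is required that for all $X\subseteq\mathbb N$ and all $g_1,\dots,g_n\subseteq\mathbb N$ in $\mathcal F$ there is a unique $f\subseteq\mathbb N$ satisfying $f:=\mathrm{op}(g_1,\dots,g_n)$ and $f\in\mathcal F$. Used with set constants in place of set variables, such an operator is a schema. The oracle operator $f:=X_\ast$ is $\forall x((x\in X\to f(x)=1)\land(x\notin X\to f(x)=0))$. A class of function algebras $\mathcal A$ is given by a finite tuple of function operators; it is required throughout that this tuple contains the following operators, each the universal closure of the displayed formula: - $f:=\mathrm S$: $f(x)=S(x)$; - $f:=\oplus$: $f(x,y)=x+y\land f(0)=0$; - $f:=\otimes$: $f(x,y)=x\cdot y\land f(0)=0$; - $f:={<_\ast}$: $(x<y\to f(x,y)=1)\land(x\ge y\to f(x,y)=0)\land f(0)=0$; - $f:=\mathrm I$: $f(x)=x$; - $f:=\mathrm D$: $f(0,y,z)=y\land f(S(x),y,z)=z\land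 f(0)=0\land f(x,0)=0$; - $f:=\mathrm P(g,h)$: $g(x)=v\land h(x)=w\to f(x)=(v,w)$; - $f:=g\circ h$: $h(x)=z\land g(z)=y\to f(x)=y$; - $f:=\mu(g)$: $(f(b,x)=z\to z\le b)\land(f(b,x)=z\land y<b\land g(y,x)=1\to z\le y)\land(f(b,x)=z\land z<b\to g(z,x)=1)\land f(0)=0$. **Derivations, $\mathcal A\mathsf{RA}_1$, standard models.** Derivations in $\mathcal A$ are the least set of formal terms containing the symbol $X_\ast$ and containing $\mathrm{op}(d_1,\dots,d_n)$ for each $n$-ary operator $\mathrm{op}$ of $\mathcal A$ and derivations $d_1,\dots,d_n$. The recursive arithmetic $\mathcal A\mathsf{RA}_1$ is the theory in $L_1(X,\vec f)$ consisting of BASIC, the axioms $f_{X_\ast}:=X_\ast$ and $f_{X_\ast}\in\mathcal F$, and for each operator and derivations $d_1,\dots,d_n$ the axioms $f_{\mathrm{op}(d_1,\dots,d_n)}:=\mathrm{op}(f_{d_1},\dots,f_{d_n})$ and $f_{\mathrm{op}(d_1,\dots,d_n)}\in\mathcal F$. For each $X\subseteq\mathbb N$ the structure $(\mathbb N,X)$ expands uniquely to a model $(\mathbb N,X,\vec f)$ of $\mathcal A\mathsf{RA}_1$, called a standard model. **Provably total functions.** A provably total function of $\mathcal A\mathsf{RA}_1$ is a function $f\colon\mathbb N\times 2^{\mathbb N}\to\mathbb N$ for which there is a $\Sigma^0_1$ formula $\varphi(x,y)$ of $L_1(X,\vec f)$ (existential number quantifiers followed by a bounded formula, in which $X$ and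 $\vec f$ may occur) without parameters such that (a) $\mathcal A\mathsf{RA}_1\vdash\forall x\exists!y\,\varphi(x,y)$ and (b) for all $X\subseteq\mathbb N$ and $x\in\mathbb N$ the standard model $(\mathbb N,X,\vec f)$ satisfies $\varphi(x,f(x,X))$. -}

module Defs where

open import Data.Bool using (Bool; true; false; if_then_else_; T)
open import Data.Empty using (⊥)
open import Data.Fin using (Fin; zero; suc)
open import Data.List using (List; []; _∷_; length; lookup)
import Data.List as List
open import Data.List.Membership.Propositional using (_∈_)
open import Data.List.Membership.Propositional.Properties using (∈-lookup)
open import Data.List.Relation.Binary.Subset.Propositional using (_⊆_)
open import Data.List.Relation.Unary.All as All using (All; []; _∷_)
open import Data.List.Relation.Unary.Any using (here; there)
open import Data.Nat using (ℕ; zero; suc; _+_; _*_; _<_; _≤_; z≤n; s≤s; s≤s⁻¹; _≡ᵇ_)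
open import Data.Nat.Properties
open import Data.Nat.Solver using (module +-*-Solver)
open import Data.Product using (Σ; ∃; ∃!; _×_; _,_; proj₁; proj₂)
open import Data.Sum using (_⊎_; inj₁; inj₂)
open import Data.Unit using (⊤; tt)
open import Data.Vec using (Vec; []; _∷_)
import Data.Vec as Vec
open import Function using (_∘_)
open import Relation.Binary using (tri<; tri≈; tri>)
open import Relation.Binary.PropositionalEquality
  using (_≡_; refl; sym; trans; cong; cong₂; _≗_; module ≡-Reasoning)
open import Relation.Nullary using (¬_; contradiction)

infix  9 _∈̇_ _≐_ _≺_
infixl 12 _`+_
infixl 13 _`·_
infixr 8 _∧̇_
infixr 7 _∨̇_
infixr 6 _⇒_
infix 10 ∀̇_ ∃̇_

-- De Bruijn: a term in 'Term n' has its number variables among n.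
data Term (n : ℕ) : Set where
  var        : Fin n → Term n
  `0         : Term n
  `S `H `T   : Term n → Term n
  _`+_ _`·_  : Term n → Term n → Term n
  ⟪_,_⟫      : Term n → Term n → Term n

-- Formulas of L₁ extended with unary predicate symbols p : P; 't ∈̇ p' is p(t).
data Formula (P : Set) (n : ℕ) : Set where
  _≐_ _≺_        : Term n → Term n → Formula P n
  _∈̇_            : Term n → P → Formula P n
  ⊥̇              : Formula P n
  _⇒_ _∧̇_ _∨̇_  : Formula P n → Formula P n → Formula P n
  ∀̇_ ∃̇_         : Formula P (suc n) → Formula P n

Sentence : Set → Set
Sentence P = Formula P 0

module _ {n : ℕ} where
  x₀ : Term (1 + n)
  x₀ = var zero
  x₁ : Term (2 + n)
  x₁ = var (suc zero)
  x₂ : Term (3 + n)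
  x₂ = var (suc (suc zero))
  x₃ : Term (4 + n)
  x₃ = var (suc (suc (suc zero)))

  `1 `2 : Term n
  `1 = `S `0
  `2 = `S `1

-- Simultaneous substitution; renaming is kept separate because
-- substitution under a binder needs it.
renameₜ : ∀ {m n} → (Fin m → Fin n) → Term m → Term n
renameₜ r (var i)     = var (r i)
renameₜ r `0          = `0
renameₜ r (`S t)      = `S (renameₜ r t)
renameₜ r (`H t)      = `H (renameₜ r t)
renameₜ r (`T t)      = `T (renameₜ r t)
renameₜ r (t `+ u)    = renameₜ r t `+ renameₜ r u
renameₜ r (t `· u)    = renameₜ r t `· renameₜ r u
renameₜ r ⟪ t , u ⟫   = ⟪ renameₜ r t , renameₜ r u ⟫

substₜ : ∀ {m n} → (Fin m → Term n) → Term m → Term n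
substₜ s (var i)     = s i
substₜ s `0          = `0
substₜ s (`S t)      = `S (substₜ s t)
substₜ s (`H t)      = `H (substₜ s t)
substₜ s (`T t)      = `T (substₜ s t)
substₜ s (t `+ u)    = substₜ s t `+ substₜ s u
substₜ s (t `· u)    = substₜ s t `· substₜ s u
substₜ s ⟪ t , u ⟫   = ⟪ substₜ s t , substₜ s u ⟫

wkₜ : ∀ {n} → Term n → Term (suc n)
wkₜ = renameₜ suc

liftᵣ : ∀ {m n} → (Fin m → Fin n) → Fin (suc m) → Fin (suc n)
liftᵣ r zero    = zero
liftᵣ r (suc i) = suc (r i)

liftₛ : ∀ {m n} → (Fin m → Term n) → Fin (suc m) → Term (suc n)
liftₛ s zero    = x₀
liftₛ s (suc i) = wkₜ (s i)

module _ {P : Set} where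

  infix  9 _≼_ _⟨_⟩≐_
  infix  5 _⇔̇_
  infix 10 ¬̇_

  rename : ∀ {m n} → (Fin m → Fin n) → Formula P m → Formula P n
  rename r (t ≐ u)   = renameₜ r t ≐ renameₜ r u
  rename r (t ≺ u)   = renameₜ r t ≺ renameₜ r u
  rename r (t ∈̇ p)   = renameₜ r t ∈̇ p
  rename r ⊥̇         = ⊥̇
  rename r (φ ⇒ ψ)   = rename r φ ⇒ rename r ψ
  rename r (φ ∧̇ ψ)   = rename r φ ∧̇ rename r ψ
  rename r (φ ∨̇ ψ)   = rename r φ ∨̇ rename r ψ
  rename r (∀̇ φ)     = ∀̇ rename (liftᵣ r) φ
  rename r (∃̇ φ)     = ∃̇ rename (liftᵣ r) φ

  substitute : ∀ {m n} → (Fin m → Term n) → Formula P m → Formula P n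
  substitute s (t ≐ u)   = substₜ s t ≐ substₜ s u
  substitute s (t ≺ u)   = substₜ s t ≺ substₜ s u
  substitute s (t ∈̇ p)   = substₜ s t ∈̇ p
  substitute s ⊥̇         = ⊥̇
  substitute s (φ ⇒ ψ)   = substitute s φ ⇒ substitute s ψ
  substitute s (φ ∧̇ ψ)   = substitute s φ ∧̇ substitute s ψ
  substitute s (φ ∨̇ ψ)   = substitute s φ ∨̇ substitute s ψ
  substitute s (∀̇ φ)     = ∀̇ substitute (liftₛ s) φ
  substitute s (∃̇ φ)     = ∃̇ substitute (liftₛ s) φ

  wk : ∀ {n} → Formula P n → Formula P (suc n)
  wk = rename suc

  -- φ with x₀ replaced by t and the other variables shifted down.
  inst : ∀ {n} → Formula P (suc n) → Term n → Formula P n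
  inst φ t = substitute (λ { zero → t ; (suc i) → var i }) φ

  weakenSentence : ∀ {n} → Sentence P → Formula P n
  weakenSentence = rename (λ ())

  ¬̇_ : ∀ {n} → Formula P n → Formula P n
  ¬̇ φ = φ ⇒ ⊥̇

  _⇔̇_ : ∀ {n} → Formula P n → Formula P n → Formula P n
  φ ⇔̇ ψ = (φ ⇒ ψ) ∧̇ (ψ ⇒ φ)

  _≼_ : ∀ {n} → Term n → Term n → Formula P n
  t ≼ u = t ≺ u ∨̇ t ≐ u

  ∀<̇ ∃<̇ : ∀ {n} → Term n → Formula P (suc n) → Formula P n
  ∀<̇ t φ = ∀̇ (x₀ ≺ wkₜ t ⇒ φ)
  ∃<̇ t φ = ∃̇ (x₀ ≺ wkₜ t ∧̇ φ)

  -- ∃! x₀ φ, as ∃ y (φ(y) ∧ ∀ y' (φ(y') → y' = y)).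
  ∃!̇ : ∀ {n} → Formula P (suc n) → Formula P n
  ∃!̇ φ = ∃̇ (φ ∧̇ ∀̇ (rename (liftᵣ suc) φ ⇒ x₀ ≐ x₁))

  ∀* : ∀ n → Formula P n → Sentence P
  ∀* zero    φ = φ
  ∀* (suc n) φ = ∀* n (∀̇ φ)

  _⟨_⟩≐_ : ∀ {n} → P → Term n → Term n → Formula P n
  p ⟨ t ⟩≐ s = ⟪ t , s ⟫ ∈̇ p

  -- p ∈ 𝓕: p is (the graph of) a total function.
  _∈𝓕 : P → Sentence P
  p ∈𝓕 =
       ∀̇ ∃̇ (⟪ x₁ , x₀ ⟫ ∈̇ p)
    ∧̇ ∀* 3 (⟪ x₀ , x₁ ⟫ ∈̇ p ∧̇ ⟪ x₀ , x₂ ⟫ ∈̇ p ⇒ x₁ ≐ x₂)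
    ∧̇ ¬̇ (`0 ∈̇ p)

  data QuantifierFree {n : ℕ} : Formula P n → Set where
    _≐_  : ∀ t u → QuantifierFree (t ≐ u)
    _≺_  : ∀ t u → QuantifierFree (t ≺ u)
    _∈̇_  : ∀ t p → QuantifierFree (t ∈̇ p)
    ⊥̇    : QuantifierFree ⊥̇
    _⇒_  : ∀ {φ ψ} → QuantifierFree φ → QuantifierFree ψ → QuantifierFree (φ ⇒ ψ)
    _∧̇_  : ∀ {φ ψ} → QuantifierFree φ → QuantifierFree ψ → QuantifierFree (φ ∧̇ ψ)
    _∨̇_  : ∀ {φ ψ} → QuantifierFree φ → QuantifierFree ψ → QuantifierFree (φ ∨̇ ψ)

  data Bounded : ∀ {n} → Formula P n → Set where
    _≐_  : ∀ {n} (t u : Term n) → Bounded (t ≐ u)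
    _≺_  : ∀ {n} (t u : Term n) → Bounded (t ≺ u)
    _∈̇_  : ∀ {n} (t : Term n) p → Bounded (t ∈̇ p)
    ⊥̇    : ∀ {n} → Bounded {n} ⊥̇
    _⇒_  : ∀ {n} {φ ψ : Formula P n} → Bounded φ → Bounded ψ → Bounded (φ ⇒ ψ)
    _∧̇_  : ∀ {n} {φ ψ : Formula P n} → Bounded φ → Bounded ψ → Bounded (φ ∧̇ ψ)
    _∨̇_  : ∀ {n} {φ ψ : Formula P n} → Bounded φ → Bounded ψ → Bounded (φ ∨̇ ψ)
    all< : ∀ {n} (t : Term n) {φ : Formula P (suc n)} → Bounded φ → Bounded (∀<̇ t φ)
    ex<  : ∀ {n} (t : Term n) {φ : Formula P (suc n)} → Bounded φ → Bounded (∃<̇ t φ)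

  data Σ⁰₁ : ∀ {n} → Formula P n → Set where
    bounded : ∀ {n} {φ : Formula P n} → Bounded φ → Σ⁰₁ φ
    ∃̇_      : ∀ {n} {φ : Formula P (suc n)} → Σ⁰₁ φ → Σ⁰₁ (∃̇ φ)

mapSet : ∀ {P Q : Set} {n} → (P → Q) → Formula P n → Formula Q n
mapSet h (t ≐ u)   = t ≐ u
mapSet h (t ≺ u)   = t ≺ u
mapSet h (t ∈̇ p)   = t ∈̇ h p
mapSet h ⊥̇         = ⊥̇
mapSet h (φ ⇒ ψ)   = mapSet h φ ⇒ mapSet h ψ
mapSet h (φ ∧̇ ψ)   = mapSet h φ ∧̇ mapSet h ψ
mapSet h (φ ∨̇ ψ)   = mapSet h φ ∨̇ mapSet h ψ
mapSet h (∀̇ φ)     = ∀̇ mapSet h φ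
mapSet h (∃̇ φ)     = ∃̇ mapSet h φ

-- Natural deduction for classical logic with equality; the axioms are the
-- sentences in Θ and Γ holds the open assumptions.
infix 3 _∣_⊢_

data _∣_⊢_ {P : Set} (Θ : Sentence P → Set) :
           ∀ {n} → List (Formula P n) → Formula P n → Set where
  axiom  : ∀ {n} {Γ : List (Formula P n)} {σ} → Θ σ → Θ ∣ Γ ⊢ weakenSentence σ
  assume : ∀ {n} {Γ : List (Formula P n)} {φ} → φ ∈ Γ → Θ ∣ Γ ⊢ φ
  raa    : ∀ {n} {Γ : List (Formula P n)} {φ} → Θ ∣ ¬̇ φ ∷ Γ ⊢ ⊥̇ → Θ ∣ Γ ⊢ φ
  ⇒I     : ∀ {n} {Γ : List (Formula P n)} {φ ψ} → Θ ∣ φ ∷ Γ ⊢ ψ → Θ ∣ Γ ⊢ φ ⇒ ψ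
  ⇒E     : ∀ {n} {Γ : List (Formula P n)} {φ ψ} → Θ ∣ Γ ⊢ φ ⇒ ψ → Θ ∣ Γ ⊢ φ → Θ ∣ Γ ⊢ ψ
  ∧I     : ∀ {n} {Γ : List (Formula P n)} {φ ψ} → Θ ∣ Γ ⊢ φ → Θ ∣ Γ ⊢ ψ → Θ ∣ Γ ⊢ φ ∧̇ ψ
  ∧E₁    : ∀ {n} {Γ : List (Formula P n)} {φ ψ} → Θ ∣ Γ ⊢ φ ∧̇ ψ → Θ ∣ Γ ⊢ φ
  ∧E₂    : ∀ {n} {Γ : List (Formula P n)} {φ ψ} → Θ ∣ Γ ⊢ φ ∧̇ ψ → Θ ∣ Γ ⊢ ψ
  ∨I₁    : ∀ {n} {Γ : List (Formula P n)} {φ ψ} → Θ ∣ Γ ⊢ φ → Θ ∣ Γ ⊢ φ ∨̇ ψ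
  ∨I₂    : ∀ {n} {Γ : List (Formula P n)} {φ ψ} → Θ ∣ Γ ⊢ ψ → Θ ∣ Γ ⊢ φ ∨̇ ψ
  ∨E     : ∀ {n} {Γ : List (Formula P n)} {φ ψ χ} →
           Θ ∣ Γ ⊢ φ ∨̇ ψ → Θ ∣ φ ∷ Γ ⊢ χ → Θ ∣ ψ ∷ Γ ⊢ χ → Θ ∣ Γ ⊢ χ
  ∀I     : ∀ {n} {Γ : List (Formula P n)} {φ} → Θ ∣ List.map wk Γ ⊢ φ → Θ ∣ Γ ⊢ ∀̇ φ
  ∀E     : ∀ {n} {Γ : List (Formula P n)} {φ} → Θ ∣ Γ ⊢ ∀̇ φ → ∀ t → Θ ∣ Γ ⊢ inst φ t
  ∃I     : ∀ {n} {Γ : List (Formula P n)} {φ} t → Θ ∣ Γ ⊢ inst φ t → Θ ∣ Γ ⊢ ∃̇ φ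
  ∃E     : ∀ {n} {Γ : List (Formula P n)} {φ χ} →
           Θ ∣ Γ ⊢ ∃̇ φ → Θ ∣ φ ∷ List.map wk Γ ⊢ wk χ → Θ ∣ Γ ⊢ χ
  ≐I     : ∀ {n} {Γ : List (Formula P n)} t → Θ ∣ Γ ⊢ t ≐ t
  ≐E     : ∀ {n} {Γ : List (Formula P n)} φ {t u} →
           Θ ∣ Γ ⊢ t ≐ u → Θ ∣ Γ ⊢ inst φ t → Θ ∣ Γ ⊢ inst φ u

-- (x , y) = (x + y)(x + y + 1)/2 + x + 1, so 0 is the only non-pair.
triangular : ℕ → ℕ
triangular zero    = 0
triangular (suc n) = suc n + triangular n

pair : ℕ → ℕ → ℕ
pair x y = suc (triangular (x + y) + x)

-- Runs through the pairs in increasing order of their codes.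
next : ℕ × ℕ → ℕ × ℕ
next (x , suc y) = suc x , y
next (x , zero)  = 0 , suc x

enumerate : ℕ → ℕ × ℕ
enumerate zero    = 0 , 0
enumerate (suc n) = next (enumerate n)

head tail : ℕ → ℕ
head zero    = 0
head (suc n) = proj₁ (enumerate n)
tail zero    = 0
tail (suc n) = proj₂ (enumerate n)

-- Elements of 2^ℕ, i.e. characteristic functions.
Subset : Set
Subset = ℕ → Bool

⟦_⟧ : ∀ {n} → Term n → Vec ℕ n → ℕ
⟦ var i ⟧ ρ       = Vec.lookup ρ i
⟦ `0 ⟧ ρ          = 0
⟦ `S t ⟧ ρ        = suc (⟦ t ⟧ ρ)
⟦ `H t ⟧ ρ        = head (⟦ t ⟧ ρ)
⟦ `T t ⟧ ρ        = tail (⟦ t ⟧ ρ)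
⟦ t `+ u ⟧ ρ      = ⟦ t ⟧ ρ + ⟦ u ⟧ ρ
⟦ t `· u ⟧ ρ      = ⟦ t ⟧ ρ * ⟦ u ⟧ ρ
⟦ ⟪ t , u ⟫ ⟧ ρ   = pair (⟦ t ⟧ ρ) (⟦ u ⟧ ρ)

infix 3 _⊨_[_] _⊨_

-- Entry i of the assignment is the value of variable i.
_⊨_[_] : ∀ {P : Set} {n} → (P → Subset) → Formula P n → Vec ℕ n → Set
I ⊨ t ≐ u   [ ρ ] = ⟦ t ⟧ ρ ≡ ⟦ u ⟧ ρ
I ⊨ t ≺ u   [ ρ ] = ⟦ t ⟧ ρ < ⟦ u ⟧ ρ
I ⊨ t ∈̇ p   [ ρ ] = I p (⟦ t ⟧ ρ) ≡ true
I ⊨ ⊥̇       [ ρ ] = ⊥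
I ⊨ φ ⇒ ψ   [ ρ ] = I ⊨ φ [ ρ ] → I ⊨ ψ [ ρ ]
I ⊨ φ ∧̇ ψ   [ ρ ] = I ⊨ φ [ ρ ] × I ⊨ ψ [ ρ ]
I ⊨ φ ∨̇ ψ   [ ρ ] = I ⊨ φ [ ρ ] ⊎ I ⊨ ψ [ ρ ]
I ⊨ ∀̇ φ     [ ρ ] = ∀ a → I ⊨ φ [ a ∷ ρ ]
I ⊨ ∃̇ φ     [ ρ ] = ∃ λ a → I ⊨ φ [ a ∷ ρ ]

_⊨_ : ∀ {P : Set} → (P → Subset) → Sentence P → Set
I ⊨ σ = I ⊨ σ [ [] ]

Functional : Subset → Set
Functional Y = (λ (_ : ⊤) → Y) ⊨ (tt ∈𝓕)

BASIC : ∀ {P} → List (Sentence P)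
BASIC =
    ∀* 1 (¬̇ (`S x₀ ≐ `0))
  ∷ ∀* 2 (`S x₀ ≐ `S x₁ ⇒ x₀ ≐ x₁)
  ∷ ∀* 1 (x₀ `+ `0 ≐ x₀)
  ∷ ∀* 2 (x₀ `+ `S x₁ ≐ `S (x₀ `+ x₁))
  ∷ ∀* 1 (x₀ `· `0 ≐ `0)
  ∷ ∀* 2 (x₀ `· `S x₁ ≐ x₀ `· x₁ `+ x₀)
  ∷ ∀* 1 (¬̇ (x₀ ≺ `0))
  ∷ ∀* 2 (x₀ ≺ `S x₁ ⇔̇ x₀ ≺ x₁ ∨̇ x₀ ≐ x₁)
  ∷ ∀* 2 (x₀ ≺ x₁ ∨̇ x₀ ≐ x₁ ∨̇ x₁ ≺ x₀)
  ∷ ∀* 1 (`0 ≺ x₀ ⇒ ∃<̇ x₀ (`S x₀ ≐ x₁))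
  ∷ ∀* 3 (⟪ x₀ , x₁ ⟫ ≐ x₂ ⇔̇ `2 `· x₂ ≐ (x₀ `+ x₁) `· (x₀ `+ x₁ `+ `1) `+ `2 `· x₀ `+ `2)
  ∷ ∀* 4 (⟪ x₀ , x₁ ⟫ ≐ ⟪ x₂ , x₃ ⟫ ⇒ x₀ ≐ x₂ ∧̇ x₁ ≐ x₃)
  ∷ ∀* 1 (`0 ≺ x₀ ⇒ ∃<̇ x₀ (∃<̇ x₁ (⟪ x₁ , x₀ ⟫ ≐ x₂)))
  ∷ ∀* 2 (`H ⟪ x₀ , x₁ ⟫ ≐ x₀)
  ∷ `H `0 ≐ `0
  ∷ ∀* 2 (`T ⟪ x₀ , x₁ ⟫ ≐ x₁)
  ∷ `T `0 ≐ `0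
  ∷ []

-- In f := op(g₁,…,gₙ) the output is f and the inputs are g₁,…,gₙ.  The
-- oracle X is a parameter that an operator, such as oracleOp, may mention.
data SetVar (n : ℕ) : Set where
  output oracle : SetVar n
  input         : Fin n → SetVar n

record Operator : Set where
  constructor operator
  field
    arity  : ℕ
    {vars} : ℕ
    matrix : Formula (SetVar arity) vars

  definition : Sentence (SetVar arity)
  definition = ∀* vars matrix

open Operator

assign : ∀ {n} → Subset → (Fin n → Subset) → Subset → SetVar n → Subset
assign X g f output    = f
assign X g f oracle    = X
assign X g f (input i) = g i

IsFunctionOperator : Operator → Set
IsFunctionOperator o =
  QuantifierFree (matrix o) ×
  (∀ X (g : Fin (arity o) → Subset) → (∀ i → Functional (g i)) →
   ∃! _≗_ λ f → (assign X g f ⊨ definition o) × Functional f)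

oracleOp : Operator
oracleOp = operator 0 {1}
  ( (x₀ ∈̇ oracle ⇒ output ⟨ x₀ ⟩≐ `1)
  ∧̇ (¬̇ (x₀ ∈̇ oracle) ⇒ output ⟨ x₀ ⟩≐ `0) )

successorOp plusOp timesOp lessOp identityOp conditionalOp pairingOp compositionOp
  minimizationOp : Operator

successorOp = operator 0 {1} (output ⟨ x₀ ⟩≐ `S x₀)

plusOp = operator 0 {2}
  (output ⟨ ⟪ x₀ , x₁ ⟫ ⟩≐ (x₀ `+ x₁) ∧̇ output ⟨ `0 ⟩≐ `0)

timesOp = operator 0 {2}
  (output ⟨ ⟪ x₀ , x₁ ⟫ ⟩≐ (x₀ `· x₁) ∧̇ output ⟨ `0 ⟩≐ `0)

lessOp = operator 0 {2}
  ( (x₀ ≺ x₁ ⇒ output ⟨ ⟪ x₀ , x₁ ⟫ ⟩≐ `1)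
  ∧̇ (x₁ ≼ x₀ ⇒ output ⟨ ⟪ x₀ , x₁ ⟫ ⟩≐ `0)
  ∧̇ output ⟨ `0 ⟩≐ `0 )

identityOp = operator 0 {1} (output ⟨ x₀ ⟩≐ x₀)

conditionalOp = operator 0 {3} (let x = x₀; y = x₁; z = x₂ in
     output ⟨ ⟪ `0 , ⟪ y , z ⟫ ⟫ ⟩≐ y
  ∧̇ output ⟨ ⟪ `S x , ⟪ y , z ⟫ ⟫ ⟩≐ z
  ∧̇ output ⟨ `0 ⟩≐ `0
  ∧̇ output ⟨ ⟪ x , `0 ⟫ ⟩≐ `0)

pairingOp = operator 2 {3} (let x = x₀; v = x₁; w = x₂; g = input zero; h = input (suc zero) in
  g ⟨ x ⟩≐ v ∧̇ h ⟨ x ⟩≐ w ⇒ output ⟨ x ⟩≐ ⟪ v , w ⟫)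

compositionOp = operator 2 {3} (let x = x₀; y = x₁; z = x₂; g = input zero; h = input (suc zero) in
  h ⟨ x ⟩≐ z ∧̇ g ⟨ z ⟩≐ y ⇒ output ⟨ x ⟩≐ y)

minimizationOp = operator 1 {4} (let b = x₀; x = x₁; y = x₂; z = x₃; g = input zero in
     (output ⟨ ⟪ b , x ⟫ ⟩≐ z ⇒ z ≼ b)
  ∧̇ (output ⟨ ⟪ b , x ⟫ ⟩≐ z ∧̇ y ≺ b ∧̇ g ⟨ ⟪ y , x ⟫ ⟩≐ `1 ⇒ z ≼ y)
  ∧̇ (output ⟨ ⟪ b , x ⟫ ⟩≐ z ∧̇ z ≺ b ⇒ g ⟨ ⟪ z , x ⟫ ⟩≐ `1)
  ∧̇ output ⟨ `0 ⟩≐ `0)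

requiredOps : List Operator
requiredOps =
  successorOp ∷ plusOp ∷ timesOp ∷ lessOp ∷ identityOp ∷ conditionalOp ∷ pairingOp ∷
  compositionOp ∷ minimizationOp ∷ []

record AlgebraClass : Set where
  field
    operators   : List Operator
    areFunction : All IsFunctionOperator operators
    hasRequired : requiredOps ⊆ operators

  Index : Set
  Index = Fin (length operators)

  op : Index → Operator
  op = lookup operators

open AlgebraClass

data Derivation (𝓐 : AlgebraClass) : Set where
  X⋆    : Derivation 𝓐
  apply : (i : Index 𝓐) → Vec (Derivation 𝓐) (arity (op 𝓐 i)) → Derivation 𝓐

data SetConst (𝓐 : AlgebraClass) : Set where
  𝐗 : SetConst 𝓐
  𝐟 : Derivation 𝓐 → SetConst 𝓐

module _ {𝓐 : AlgebraClass} where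

  constants : ∀ {n} → Derivation 𝓐 → Vec (Derivation 𝓐) n → SetVar n → SetConst 𝓐
  constants d ds output    = 𝐟 d
  constants d ds oracle    = 𝐗
  constants d ds (input i) = 𝐟 (Vec.lookup ds i)

  -- f_{op(d₁,…,dₙ)} := op(f_{d₁},…,f_{dₙ})
  definingAxiom : Derivation 𝓐 → Sentence (SetConst 𝓐)
  definingAxiom d@X⋆           = mapSet (constants d []) (definition oracleOp)
  definingAxiom d@(apply i ds) = mapSet (constants d ds) (definition (op 𝓐 i))

  interpretation : Subset → (Derivation 𝓐 → Subset) → SetConst 𝓐 → Subset
  interpretation O F 𝐗     = O
  interpretation O F (𝐟 d) = F d

data RA₁ (𝓐 : AlgebraClass) : Sentence (SetConst 𝓐) → Set where
  basic    : ∀ {σ} → σ ∈ BASIC → RA₁ 𝓐 σ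
  defining : ∀ d → RA₁ 𝓐 (definingAxiom d)
  total    : ∀ d → RA₁ 𝓐 (𝐟 d ∈𝓕)

-- A standard model over O is an expansion of (ℕ, O) to a model of RA₁ 𝓐.
-- It exists and is unique: see standardModel and standardModel-unique.
record StandardModel (𝓐 : AlgebraClass) (O : Subset) : Set where
  field
    sets    : Derivation 𝓐 → Subset

  ⟦_⟧ₛ : SetConst 𝓐 → Subset
  ⟦_⟧ₛ = interpretation O sets

  field
    isModel : ∀ {σ} → RA₁ 𝓐 σ → ⟦_⟧ₛ ⊨ σ

open StandardModel

double-triangular : ∀ n → 2 * triangular n ≡ n * suc n
double-triangular zero    = refl
double-triangular (suc n) = begin
  2 * (suc n + triangular n)      ≡⟨ *-distribˡ-+ 2 (suc n) (triangular n) ⟩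
  2 * suc n + 2 * triangular n    ≡⟨ cong (2 * suc n +_) (double-triangular n) ⟩
  2 * suc n + n * suc n           ≡⟨ solve 1 (λ m → con 2 :* (con 1 :+ m) :+ m :* (con 1 :+ m)
                                       := (con 1 :+ m) :* (con 2 :+ m)) refl n ⟩
  suc n * suc (suc n)             ∎
  where
  open ≡-Reasoning
  open +-*-Solver

double-pair : ∀ x y → 2 * pair x y ≡ (x + y) * (x + y + 1) + 2 * x + 2
double-pair x y = begin
  2 * suc (triangular (x + y) + x)
    ≡⟨ solve 2 (λ t u → con 2 :* (con 1 :+ (t :+ u)) := con 2 :* t :+ con 2 :* u :+ con 2)
         refl (triangular (x + y)) x ⟩
  2 * triangular (x + y) + 2 * x + 2
    ≡⟨ cong (λ t → t + 2 * x + 2) (double-triangular (x + y)) ⟩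
  (x + y) * suc (x + y) + 2 * x + 2
    ≡⟨ cong (λ t → (x + y) * t + 2 * x + 2) (+-comm 1 (x + y)) ⟩
  (x + y) * (x + y + 1) + 2 * x + 2 ∎
  where
  open ≡-Reasoning
  open +-*-Solver

enumerate-code : ∀ s x y → x + y ≡ s → enumerate (triangular s + x) ≡ (x , y)
enumerate-code zero    zero    y refl = refl
enumerate-code (suc s) zero    y refl
  rewrite +-identityʳ (s + triangular s) | +-comm s (triangular s)
        | enumerate-code s s 0 (+-identityʳ s) = refl
enumerate-code s (suc x) y eq
  rewrite +-suc (triangular s) x
        | enumerate-code s x (suc y) (trans (+-suc x y) eq) = refl

head-pair : ∀ x y → head (pair x y) ≡ x
head-pair x y = cong proj₁ (enumerate-code (x + y) x y refl)

tail-pair : ∀ x y → tail (pair x y) ≡ y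
tail-pair x y = cong proj₂ (enumerate-code (x + y) x y refl)

code : ℕ × ℕ → ℕ
code (x , y) = pair x y

code-next : ∀ p → code (next p) ≡ suc (code p)
code-next (x , suc y) = cong suc (trans (+-suc _ x) (cong (λ s → suc (triangular s + x)) (sym (+-suc x y))))
code-next (x , zero)  = cong (λ m → suc (suc m)) (trans (+-identityʳ _)
  (trans (+-comm x _) (cong (λ s → triangular s + x) (sym (+-identityʳ x)))))

code-enumerate : ∀ n → code (enumerate n) ≡ suc n
code-enumerate zero    = refl
code-enumerate (suc n) = trans (code-next (enumerate n)) (cong suc (code-enumerate n))

n≤triangular : ∀ n → n ≤ triangular n
n≤triangular zero    = z≤n
n≤triangular (suc n) = m≤m+n (suc n) (triangular n)

x<pair : ∀ x y → x < pair x y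
x<pair x y = s≤s (m≤n+m x _)

y<pair : ∀ x y → y < pair x y
y<pair x y = s≤s (≤-trans (≤-trans (m≤n+m y x) (n≤triangular (x + y))) (m≤m+n _ x))

pair-injective : ∀ x y x' y' → pair x y ≡ pair x' y' → x ≡ x' × y ≡ y'
pair-injective x y x' y' eq =
    trans (sym (head-pair x y)) (trans (cong head eq) (head-pair x' y'))
  , trans (sym (tail-pair x y)) (trans (cong tail eq) (tail-pair x' y'))

<-suc⁻ : ∀ {x y} → x < suc y → x < y ⊎ x ≡ y
<-suc⁻ x<1+y = m≤n⇒m<n∨m≡n (s≤s⁻¹ x<1+y)

<-suc⁺ : ∀ {x y} → x < y ⊎ x ≡ y → x < suc y
<-suc⁺ (inj₁ x<y)  = m<n⇒m<1+n x<y
<-suc⁺ (inj₂ refl) = ≤-refl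

trichotomy : ∀ x y → x < y ⊎ (x ≡ y ⊎ y < x)
trichotomy x y with <-cmp x y
... | tri< x<y _ _ = inj₁ x<y
... | tri≈ _ x≡y _ = inj₂ (inj₁ x≡y)
... | tri> _ _ y<x = inj₂ (inj₂ y<x)

pair-surjective : ∀ z → 0 < z → ∃ λ x → x < z × (∃ λ y → y < z × pair x y ≡ z)
pair-surjective (suc n) _ with enumerate n | code-enumerate n
... | x , y | eq rewrite sym eq = x , x<pair x y , y , y<pair x y , refl

ℕ⊨BASIC : ∀ {P : Set} (I : P → Subset) → All (I ⊨_) BASIC
ℕ⊨BASIC I =
    (λ x ())
  ∷ (λ y x → suc-injective)
  ∷ (λ x → +-identityʳ x)
  ∷ (λ y x → +-suc x y)
  ∷ (λ x → *-zeroʳ x)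
  ∷ (λ y x → trans (*-suc x y) (+-comm x (x * y)))
  ∷ (λ x ())
  ∷ (λ y x → <-suc⁻ , <-suc⁺)
  ∷ (λ y x → trichotomy x y)
  ∷ (λ { (suc x) _ → x , ≤-refl , refl })
  ∷ (λ z y x → (λ { refl → double-pair x y })
             , (λ eq → *-cancelˡ-≡ (pair x y) z 2 (trans (double-pair x y) (sym eq))))
  ∷ (λ y' x' y x → pair-injective x y x' y')
  ∷ pair-surjective
  ∷ (λ y x → head-pair x y)
  ∷ refl
  ∷ (λ y x → tail-pair x y)
  ∷ refl
  ∷ []

module MapSet {P Q : Set} (I : P → Subset) (J : Q → Subset) (h : P → Q)
              (J≗I : ∀ p → J (h p) ≗ I p) where
  mapSet⁺ : ∀ {n} (φ : Formula P n) ρ → I ⊨ φ [ ρ ] → J ⊨ mapSet h φ [ ρ ]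
  mapSet⁻ : ∀ {n} (φ : Formula P n) ρ → J ⊨ mapSet h φ [ ρ ] → I ⊨ φ [ ρ ]

  mapSet⁺ (t ≐ u)  ρ s        = s
  mapSet⁺ (t ≺ u)  ρ s        = s
  mapSet⁺ (t ∈̇ p)  ρ s        = trans (J≗I p _) s
  mapSet⁺ (φ ⇒ ψ)  ρ s        = mapSet⁺ ψ ρ ∘ s ∘ mapSet⁻ φ ρ
  mapSet⁺ (φ ∧̇ ψ)  ρ (s , s') = mapSet⁺ φ ρ s , mapSet⁺ ψ ρ s'
  mapSet⁺ (φ ∨̇ ψ)  ρ (inj₁ s) = inj₁ (mapSet⁺ φ ρ s)
  mapSet⁺ (φ ∨̇ ψ)  ρ (inj₂ s) = inj₂ (mapSet⁺ ψ ρ s)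
  mapSet⁺ (∀̇ φ)    ρ s        = λ a → mapSet⁺ φ (a ∷ ρ) (s a)
  mapSet⁺ (∃̇ φ)    ρ (a , s)  = a , mapSet⁺ φ (a ∷ ρ) s

  mapSet⁻ (t ≐ u)  ρ s        = s
  mapSet⁻ (t ≺ u)  ρ s        = s
  mapSet⁻ (t ∈̇ p)  ρ s        = trans (sym (J≗I p _)) s
  mapSet⁻ (φ ⇒ ψ)  ρ s        = mapSet⁻ ψ ρ ∘ s ∘ mapSet⁺ φ ρ
  mapSet⁻ (φ ∧̇ ψ)  ρ (s , s') = mapSet⁻ φ ρ s , mapSet⁻ ψ ρ s'
  mapSet⁻ (φ ∨̇ ψ)  ρ (inj₁ s) = inj₁ (mapSet⁻ φ ρ s)
  mapSet⁻ (φ ∨̇ ψ)  ρ (inj₂ s) = inj₂ (mapSet⁻ ψ ρ s)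
  mapSet⁻ (∀̇ φ)    ρ s        = λ a → mapSet⁻ φ (a ∷ ρ) (s a)
  mapSet⁻ (∃̇ φ)    ρ (a , s)  = a , mapSet⁻ φ (a ∷ ρ) s

graph : (ℕ → ℕ) → Subset
graph F zero      = false
graph F z@(suc _) = tail z ≡ᵇ F (head z)

graph⁺ : ∀ F x → graph F (pair x (F x)) ≡ true
graph⁺ F x rewrite enumerate-code (x + F x) x (F x) refl = T⇒≡ (≡⇒≡ᵇ (F x) (F x) refl)
  where
  T⇒≡ : ∀ {b} → T b → b ≡ true
  T⇒≡ {true} _ = refl

graph⁻ : ∀ F x y → graph F (pair x y) ≡ true → y ≡ F x
graph⁻ F x y eq rewrite enumerate-code (x + y) x y refl = ≡ᵇ⇒≡ y (F x) (≡⇒T eq)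
  where
  ≡⇒T : ∀ {b} → b ≡ true → T b
  ≡⇒T refl = tt

graph-functional : ∀ F → Functional (graph F)
graph-functional F =
    (λ x → F x , graph⁺ F x)
  , (λ { y' y x (p , q) → trans (graph⁻ F x y p) (sym (graph⁻ F x y' q)) })
  , λ ()

functional-unique : ∀ {Y Z} → Functional Y → Functional Z →
                    (∀ x → ∃ λ y → Y (pair x y) ≡ true × Z (pair x y) ≡ true) → Y ≗ Z
functional-unique {Y} {Z} (_ , uY , 0∉Y) (_ , uZ , 0∉Z) common z =
  ≡true-ext (incl Y Z uY 0∉Y z (λ x → common x))
            (incl Z Y uZ 0∉Z z (λ x → let y , p , q = common x in y , q , p))
  where
  ≡true-ext : ∀ {b c} → (b ≡ true → c ≡ true) → (c ≡ true → b ≡ true) → b ≡ c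
  ≡true-ext {false} {false} _ _ = refl
  ≡true-ext {false} {true}  _ g = g refl
  ≡true-ext {true}  {false} f _ = sym (f refl)
  ≡true-ext {true}  {true}  _ _ = refl

  incl : ∀ (Y Z : Subset) →
         (∀ y' y x → Y (pair x y) ≡ true × Y (pair x y') ≡ true → y ≡ y') → ¬ Y 0 ≡ true →
         ∀ z → (∀ x → ∃ λ y → Y (pair x y) ≡ true × Z (pair x y) ≡ true) →
         Y z ≡ true → Z z ≡ true
  incl Y Z u 0∉ zero    c z∈Y = contradiction z∈Y 0∉
  incl Y Z u 0∉ (suc n) c z∈Y
    with x , _ , y , _ , eq ← pair-surjective (suc n) (s≤s z≤n)
    rewrite sym eq
    with y' , p , q ← c x
    rewrite u y' y x (z∈Y , p) = q

oracleOp-isFunctionOperator : IsFunctionOperator oracleOp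
oracleOp-isFunctionOperator =
    (((_ ∈̇ _) ⇒ (_ ∈̇ _)) ∧̇ (((_ ∈̇ _) ⇒ ⊥̇) ⇒ (_ ∈̇ _)))
  , λ O g _ → let χ = λ x → if O x then 1 else 0 in
      graph χ
    , ( (λ x → (λ x∈O → value O x (cong (if_then 1 else 0) x∈O))
             , (λ x∉O → value O x (cong (if_then 1 else 0) (¬true x∉O))))
      , graph-functional χ )
    , λ {Y} (def , Y∈𝓕) → functional-unique (graph-functional χ) Y∈𝓕 (common O Y def)
  where
  value : ∀ (O : Subset) x {v} → (if O x then 1 else 0) ≡ v →
          graph (λ x → if O x then 1 else 0) (pair x v) ≡ true
  value O x refl = graph⁺ (λ x → if O x then 1 else 0) x

  ¬true : ∀ {b} → ¬ b ≡ true → b ≡ false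
  ¬true {false} _ = refl
  ¬true {true}  n = contradiction refl n

  common : ∀ (O Y : Subset) →
           (∀ x → (O x ≡ true → Y (pair x 1) ≡ true) × ((O x ≡ true → ⊥) → Y (pair x 0) ≡ true)) →
           ∀ x → ∃ λ y → graph (λ x → if O x then 1 else 0) (pair x y) ≡ true × Y (pair x y) ≡ true
  common O Y def x with O x in eq | def x
  ... | true  | p , _ = 1 , value O x (cong (if_then 1 else 0) eq) , p refl
  ... | false | _ , q = 0 , value O x (cong (if_then 1 else 0) eq) , q (λ ())

module _ {𝓐 : AlgebraClass} where

  op-isFunctionOperator : ∀ i → IsFunctionOperator (op 𝓐 i)
  op-isFunctionOperator i = All.lookup (areFunction 𝓐) (∈-lookup i)

  module Instance (O : Subset) (F : Derivation 𝓐 → Subset) (d : Derivation 𝓐)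
                  {n} (ds : Vec (Derivation 𝓐) n) (g : Fin n → Subset)
                  (F≗g : ∀ i → F (Vec.lookup ds i) ≗ g i) where

    constants≗ : ∀ p → interpretation O F (constants d ds p) ≗ assign O g (F d) p
    constants≗ output    _ = refl
    constants≗ oracle    _ = refl
    constants≗ (input i) z = F≗g i z

    instance⁺ : ∀ σ → assign O g (F d) ⊨ σ → interpretation O F ⊨ mapSet (constants d ds) σ
    instance⁺ σ = MapSet.mapSet⁺ (assign O g (F d)) (interpretation O F) (constants d ds) constants≗ σ []

    instance⁻ : ∀ σ → interpretation O F ⊨ mapSet (constants d ds) σ → assign O g (F d) ⊨ σ
    instance⁻ σ = MapSet.mapSet⁻ (assign O g (F d)) (interpretation O F) (constants d ds) constants≗ σ []

  module _ (O : Subset) where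

    standardSet  : Derivation 𝓐 → Σ Subset Functional
    standardSets : ∀ {n} → Vec (Derivation 𝓐) n → Fin n → Σ Subset Functional

    standardSet X⋆ =
      let Y , (_ , Y∈𝓕) , _ = proj₂ oracleOp-isFunctionOperator O (λ ()) (λ ()) in Y , Y∈𝓕
    standardSet (apply i ds) =
      let Y , (_ , Y∈𝓕) , _ = proj₂ (op-isFunctionOperator i) O
                                (proj₁ ∘ standardSets ds) (proj₂ ∘ standardSets ds)
      in Y , Y∈𝓕
    standardSets (d ∷ ds) zero    = standardSet d
    standardSets (d ∷ ds) (suc i) = standardSets ds i

    standardSets-lookup : ∀ {n} (ds : Vec (Derivation 𝓐) n) i →
                          standardSet (Vec.lookup ds i) ≡ standardSets ds i
    standardSets-lookup (d ∷ ds) zero    = refl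
    standardSets-lookup (d ∷ ds) (suc i) = standardSets-lookup ds i

    standardModel : StandardModel 𝓐 O
    standardModel .sets = proj₁ ∘ standardSet
    standardModel .isModel (basic σ∈) = All.lookup (ℕ⊨BASIC _) σ∈
    standardModel .isModel (total d)  = proj₂ (standardSet d)
    standardModel .isModel (defining X⋆) =
      let _ , (def , _) , _ = proj₂ oracleOp-isFunctionOperator O (λ ()) (λ ())
      in Instance.instance⁺ O (proj₁ ∘ standardSet) X⋆ [] (λ ()) (λ ()) (definition oracleOp) def
    standardModel .isModel (defining d@(apply i ds)) =
      let _ , (def , _) , _ = proj₂ (op-isFunctionOperator i) O
                                (proj₁ ∘ standardSets ds) (proj₂ ∘ standardSets ds)
      in Instance.instance⁺ O (proj₁ ∘ standardSet) d ds (proj₁ ∘ standardSets ds)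
           (λ j z → cong (λ Y → proj₁ Y z) (standardSets-lookup ds j)) (definition (op 𝓐 i)) def

    module _ (M N : StandardModel 𝓐 O) where

      standardModel-unique  : ∀ d → sets M d ≗ sets N d
      standardModels-unique : ∀ {n} (ds : Vec (Derivation 𝓐) n) i →
                              sets M (Vec.lookup ds i) ≗ sets N (Vec.lookup ds i)

      standardModel-unique X⋆ z =
        let _ , _ , unique = proj₂ oracleOp-isFunctionOperator O (λ ()) (λ ())
        in trans (sym (unique {sets M X⋆} (satisfies M) z)) (unique {sets N X⋆} (satisfies N) z)
        where
        satisfies : ∀ K → (assign O (λ ()) (sets K X⋆) ⊨ definition oracleOp) × Functional (sets K X⋆)
        satisfies K =
            Instance.instance⁻ O (sets K) X⋆ [] (λ ()) (λ ()) (definition oracleOp)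
              (isModel K (defining X⋆))
          , isModel K (total X⋆)
      standardModel-unique d@(apply i ds) z =
        let _ , _ , unique = proj₂ (op-isFunctionOperator i) O (sets M ∘ Vec.lookup ds)
                               (λ j → isModel M (total (Vec.lookup ds j)))
        in trans (sym (unique {sets M d} (satisfies M (λ _ _ → refl)) z))
                 (unique {sets N d} (satisfies N (λ j z → sym (standardModels-unique ds j z))) z)
        where
        satisfies : ∀ K → (∀ j → sets K (Vec.lookup ds j) ≗ sets M (Vec.lookup ds j)) →
                    (assign O (sets M ∘ Vec.lookup ds) (sets K d) ⊨ definition (op 𝓐 i))
                    × Functional (sets K d)
        satisfies K K≗M =
            Instance.instance⁻ O (sets K) d ds (sets M ∘ Vec.lookup ds) K≗M (definition (op 𝓐 i))
              (isModel K (defining d))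
          , isModel K (total d)

      standardModels-unique (d ∷ ds) zero    = standardModel-unique d
      standardModels-unique (d ∷ ds) (suc i) = standardModels-unique ds i

-- In φ(x,y), x is x₁ and y is x₀.
record ProvablyTotal (𝓐 : AlgebraClass) (F : ℕ × Subset → ℕ) : Set where
  field
    formula    : Formula (SetConst 𝓐) 2
    isΣ⁰₁      : Σ⁰₁ formula
    provable   : RA₁ 𝓐 ∣ [] ⊢ ∀̇ (∃!̇ formula)
    defines    : ∀ O (M : StandardModel 𝓐 O) x → ⟦ M ⟧ₛ ⊨ formula [ F (x , O) ∷ x ∷ [] ]

-- d derives F: every standard model satisfies f_d(x) = F(x, X).
Derives : (𝓐 : AlgebraClass) → Derivation 𝓐 → (ℕ × Subset → ℕ) → Set
Derives 𝓐 d F =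
  ∀ O (M : StandardModel 𝓐 O) x → ⟦ M ⟧ₛ ⊨ 𝐟 d ⟨ x₁ ⟩≐ x₀ [ F (x , O) ∷ x ∷ [] ]

{-# OPTIONS --safe #-}
module Submission where

-- If d derives F, the formula (x , y) ∈ f_d shows that F is provably total:
-- its totality and uniqueness are an axiom of RA₁.
--
-- For the converse a proof of ∀x ∃!y φ(x,y) has to yield one derivation d with
-- φ(x, f_d(x)) in all standard models.  Classically, if there were no such d,
-- then the functions f_d modulo a suitable ultrafilter on the pairs (X , x)
-- would form a model of RA₁ in which ∃y φ fails at the class of the identity.
-- Forcing replaces the ultrafilter, and makes the argument constructive.  A
-- condition is a set p of pairs of a standard model and a number x, the
-- elements that the quantifiers range over are the derivations, and falsum is
-- read as 'p is settled': a single derivation gives a value of y with φ(x,y)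
-- at all points of p.  Disjunction and existence are read through double
-- negation, so that classical logic is sound for forcing ('stable', 'sound').
--
-- What makes the axioms forced is that a bounded formula is forced by p exactly
-- if the part of p where it is false is settled ('bounded⁻' and 'bounded⁺', the
-- analogue of Łoś's theorem).  This requires that derivations decide bounded
-- formulas, find least witnesses below a bound and are closed under definition
-- by cases ('charᵈ', 'searchᵈ', 'ifᵈ').  All axioms of RA₁ are true universal
-- closures of bounded formulas, except that f_d is total, where composition
-- with f_d supplies the witness.  Forcing ∃y φ(x,y) at the set of all points
-- then says that this set is settled, which is the required derivation
-- ('herbrand').
--
-- It remains to see that y is unique in the standard model, which is immediate
-- classically.  Constructively it follows from the same soundness theorem,
-- applied to a frame with a single world, with numbers as elements and with
-- 'settled' meaning empty ('provably-unique').

open import Defs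
open import Data.Bool using (true)
import Data.Bool.Properties as Bool
open import Data.Empty using (⊥; ⊥-elim)
open import Data.Fin using (Fin; zero; suc; #_)
open import Data.List using (List; []; _∷_)
import Data.List as List
open import Data.List.Membership.Propositional using (_∈_)
open import Data.List.Membership.Propositional.Properties using (∈-lookup)
open import Data.List.Relation.Unary.All as All using (All; []; _∷_)
import Data.List.Relation.Unary.All.Properties as All
open import Data.List.Relation.Unary.Any using (here; there; index)
open import Data.List.Relation.Unary.Any.Properties using (lookup-index)
open import Data.Nat using (ℕ; zero; suc; _+_; _*_; _<_; _≤_; z≤n; s≤s; _≟_; _<?_)
open import Data.Nat.Properties
  using (≤-refl; <⇒≤; <-irrefl; ≤-<-trans; m≤n⇒m<n∨m≡n; ≮⇒≥; ≤-antisym; allUpTo?; anyUpTo?)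
open import Data.Product using (∃; _×_; _,_; proj₁; proj₂)
open import Data.Sum using (_⊎_; inj₁; inj₂; [_,_]′)
open import Data.Unit using (⊤; tt)
open import Data.Vec using (Vec; []; _∷_; map; lookup)
open import Data.Vec.Properties using (lookup-map; map-∘; map-cong)
open import Function using (_∘_; id)
open import Function.Bundles using (_⇔_; mk⇔)
open import Relation.Binary.PropositionalEquality
  using (_≡_; refl; sym; trans; cong; cong₂; subst; subst₂)
open import Relation.Nullary using (¬_; Dec; yes; no; contradiction)
open import Relation.Nullary.Decidable using (map′; _→-dec_; _×-dec_; _⊎-dec_; decidable-stable)
open import Relation.Unary using (_⊆_; _∩_; ∁)

open AlgebraClass
open Operator
open StandardModel

private variable
  m n : ℕ
  P   : Set
  𝓐   : AlgebraClass

-- Terms and bounded formulas in the standard structure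

⟦rename⟧ : {r : Fin m → Fin n} {ρ : Vec ℕ m} {ρ' : Vec ℕ n} →
           (∀ i → lookup ρ' (r i) ≡ lookup ρ i) → ∀ t → ⟦ renameₜ r t ⟧ ρ' ≡ ⟦ t ⟧ ρ
⟦rename⟧ h (var i)   = h i
⟦rename⟧ h `0        = refl
⟦rename⟧ h (`S t)    = cong suc (⟦rename⟧ h t)
⟦rename⟧ h (`H t)    = cong head (⟦rename⟧ h t)
⟦rename⟧ h (`T t)    = cong tail (⟦rename⟧ h t)
⟦rename⟧ h (t `+ u)  = cong₂ _+_ (⟦rename⟧ h t) (⟦rename⟧ h u)
⟦rename⟧ h (t `· u)  = cong₂ _*_ (⟦rename⟧ h t) (⟦rename⟧ h u)
⟦rename⟧ h ⟪ t , u ⟫ = cong₂ pair (⟦rename⟧ h t) (⟦rename⟧ h u)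

⟦subst⟧ : {s : Fin m → Term n} {ρ : Vec ℕ m} {ρ' : Vec ℕ n} →
          (∀ i → ⟦ s i ⟧ ρ' ≡ lookup ρ i) → ∀ t → ⟦ substₜ s t ⟧ ρ' ≡ ⟦ t ⟧ ρ
⟦subst⟧ h (var i)   = h i
⟦subst⟧ h `0        = refl
⟦subst⟧ h (`S t)    = cong suc (⟦subst⟧ h t)
⟦subst⟧ h (`H t)    = cong head (⟦subst⟧ h t)
⟦subst⟧ h (`T t)    = cong tail (⟦subst⟧ h t)
⟦subst⟧ h (t `+ u)  = cong₂ _+_ (⟦subst⟧ h t) (⟦subst⟧ h u)
⟦subst⟧ h (t `· u)  = cong₂ _*_ (⟦subst⟧ h t) (⟦subst⟧ h u)
⟦subst⟧ h ⟪ t , u ⟫ = cong₂ pair (⟦subst⟧ h t) (⟦subst⟧ h u)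

⟦wk⟧ : ∀ (t : Term n) {z ρ} → ⟦ wkₜ t ⟧ (z ∷ ρ) ≡ ⟦ t ⟧ ρ
⟦wk⟧ t = ⟦rename⟧ (λ _ → refl) t

bounded? : (I : P → Subset) {φ : Formula P n} → Bounded φ → ∀ ρ → Dec (I ⊨ φ [ ρ ])
bounded? I (t ≐ u)    ρ = ⟦ t ⟧ ρ ≟ ⟦ u ⟧ ρ
bounded? I (t ≺ u)    ρ = ⟦ t ⟧ ρ <? ⟦ u ⟧ ρ
bounded? I (t ∈̇ p)    ρ = I p (⟦ t ⟧ ρ) Bool.≟ true
bounded? I ⊥̇          ρ = no id
bounded? I (b ⇒ c)    ρ = bounded? I b ρ →-dec bounded? I c ρ
bounded? I (b ∧̇ c)    ρ = bounded? I b ρ ×-dec bounded? I c ρ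
bounded? I (b ∨̇ c)    ρ = bounded? I b ρ ⊎-dec bounded? I c ρ
bounded? I (all< t b) ρ =
  map′ (λ h z z<t → h (subst (z <_) (⟦wk⟧ t) z<t))
       (λ h {z} z<t → h z (subst (z <_) (sym (⟦wk⟧ t)) z<t))
       (allUpTo? (λ z → bounded? I b (z ∷ ρ)) (⟦ t ⟧ ρ))
bounded? I (ex< t b)  ρ =
  map′ (λ (z , z<t , h) → z , subst (z <_) (sym (⟦wk⟧ t)) z<t , h)
       (λ (z , z<t , h) → z , subst (z <_) (⟦wk⟧ t) z<t , h)
       (anyUpTo? (λ z → bounded? I b (z ∷ ρ)) (⟦ t ⟧ ρ))

-- Classical duality, available because bounded formulas are decidable.
¬all⇒ex¬ : (I : P → Subset) (t : Term n) {φ : Formula P (suc n)} → Bounded φ → ∀ ρ →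
           ¬ (I ⊨ ∀<̇ t φ [ ρ ]) → I ⊨ ∃<̇ t (¬̇ φ) [ ρ ]
¬all⇒ex¬ I t b ρ ¬all = decidable-stable (bounded? I (ex< t (b ⇒ ⊥̇)) ρ) λ ¬ex →
  ¬all λ z z<t → decidable-stable (bounded? I b (z ∷ ρ)) λ ¬φ → ¬ex (z , z<t , ¬φ)

-- Universal axioms

data Π⁰₁ {P : Set} : ∀ {n} → Formula P n → Set where
  bounded : {φ : Formula P n} → Bounded φ → Π⁰₁ φ
  ∀̇_      : {φ : Formula P (suc n)} → Π⁰₁ φ → Π⁰₁ (∀̇ φ)

-- The existential quantifiers of the predecessor axiom and of the unpairing axiom
-- are bounded.
BASIC-Π⁰₁ : All (Π⁰₁ {P}) BASIC
BASIC-Π⁰₁ =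
    (∀̇ bounded ((_ ≐ _) ⇒ ⊥̇))
  ∷ (∀̇ ∀̇ bounded ((_ ≐ _) ⇒ (_ ≐ _)))
  ∷ (∀̇ bounded (_ ≐ _))
  ∷ (∀̇ ∀̇ bounded (_ ≐ _))
  ∷ (∀̇ bounded (_ ≐ _))
  ∷ (∀̇ ∀̇ bounded (_ ≐ _))
  ∷ (∀̇ bounded ((_ ≺ _) ⇒ ⊥̇))
  ∷ (∀̇ ∀̇ bounded (((_ ≺ _) ⇒ ((_ ≺ _) ∨̇ (_ ≐ _))) ∧̇ (((_ ≺ _) ∨̇ (_ ≐ _)) ⇒ (_ ≺ _))))
  ∷ (∀̇ ∀̇ bounded ((_ ≺ _) ∨̇ ((_ ≐ _) ∨̇ (_ ≺ _))))
  ∷ (∀̇ bounded ((_ ≺ _) ⇒ ex< x₀ (_ ≐ _)))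
  ∷ (∀̇ ∀̇ ∀̇ bounded (((_ ≐ _) ⇒ (_ ≐ _)) ∧̇ ((_ ≐ _) ⇒ (_ ≐ _))))
  ∷ (∀̇ ∀̇ ∀̇ ∀̇ bounded ((_ ≐ _) ⇒ ((_ ≐ _) ∧̇ (_ ≐ _))))
  ∷ (∀̇ bounded ((_ ≺ _) ⇒ ex< x₀ (ex< x₁ (_ ≐ _))))
  ∷ (∀̇ ∀̇ bounded (_ ≐ _))
  ∷ bounded (_ ≐ _)
  ∷ (∀̇ ∀̇ bounded (_ ≐ _))
  ∷ bounded (_ ≐ _)
  ∷ []

quantifierFree⇒bounded : ∀ {Q : Set} (h : P → Q) {φ : Formula P n} →
                         QuantifierFree φ → Bounded (mapSet h φ)
quantifierFree⇒bounded h (t ≐ u) = t ≐ u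
quantifierFree⇒bounded h (t ≺ u) = t ≺ u
quantifierFree⇒bounded h (t ∈̇ p) = t ∈̇ h p
quantifierFree⇒bounded h ⊥̇       = ⊥̇
quantifierFree⇒bounded h (b ⇒ c) = quantifierFree⇒bounded h b ⇒ quantifierFree⇒bounded h c
quantifierFree⇒bounded h (b ∧̇ c) = quantifierFree⇒bounded h b ∧̇ quantifierFree⇒bounded h c
quantifierFree⇒bounded h (b ∨̇ c) = quantifierFree⇒bounded h b ∨̇ quantifierFree⇒bounded h c

closure-Π⁰₁ : ∀ {Q : Set} (h : P → Q) n {φ : Formula P n} →
              Π⁰₁ (mapSet h φ) → Π⁰₁ (mapSet h (∀* n φ))
closure-Π⁰₁ h zero    π = π
closure-Π⁰₁ h (suc n) π = closure-Π⁰₁ h n (∀̇ π)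

universal-Π⁰₁ : ∀ {Q : Set} o (h : SetVar (arity o) → Q) → IsFunctionOperator o →
                Π⁰₁ (mapSet h (definition o))
universal-Π⁰₁ o h (qf , _) = closure-Π⁰₁ h (vars o) (bounded (quantifierFree⇒bounded h qf))

definingAxiom-Π⁰₁ : (d : Derivation 𝓐) → Π⁰₁ (definingAxiom d)
definingAxiom-Π⁰₁ X⋆ = universal-Π⁰₁ oracleOp (constants X⋆ []) oracleOp-isFunctionOperator
definingAxiom-Π⁰₁ {𝓐} d@(apply i ds) =
  universal-Π⁰₁ (op 𝓐 i) (constants d ds) (op-isFunctionOperator {𝓐} i)

-- Frames and forcing

-- What forcing needs to know about the elements that quantifiers range over
-- and about the sets of worlds that count as inconsistent.  Elements are names
-- of number-valued functions on the worlds; the closure conditions 'split',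
-- 'termName', 'imageName' and 'choose' say that there are enough of them.
record Frame (𝓐 : AlgebraClass) : Set₁ where
  field
    World Name : Set
    oracleAt   : World → Subset
    modelAt    : ∀ w → StandardModel 𝓐 (oracleAt w)
    value      : Name → World → ℕ
    Settled    : (World → Set) → Set

  at : Vec Name n → World → Vec ℕ n
  at e w = map (λ a → value a w) e

  True : Formula (SetConst 𝓐) n → Vec Name n → World → Set
  True φ e w = ⟦ modelAt w ⟧ₛ ⊨ φ [ at e w ]

  field
    settled-⊆ : ∀ {p q} → q ⊆ p → Settled p → Settled q
    settled-∅ : Settled λ _ → ⊥
    split     : ∀ {φ : Formula (SetConst 𝓐) n} → Bounded φ → ∀ e {p} →
                Settled (p ∩ True φ e) → Settled (p ∩ ∁ (True φ e)) → Settled p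
    termName  : (t : Term n) (e : Vec Name n) →
                ∃ λ a → ∀ w → value a w ≡ ⟦ t ⟧ (at e w)
    imageName : ∀ d a →
                ∃ λ b → ∀ w → sets (modelAt w) d (pair (value a w) (value b w)) ≡ true
    choose    : ∀ (t : Term n) {φ : Formula (SetConst 𝓐) (suc n)} → Bounded φ → ∀ e →
                ∃ λ a → ∀ {w} → True (∃<̇ t φ) e w → True (x₀ ≺ wkₜ t ∧̇ φ) (a ∷ e) w

module Forcing (𝔽 : Frame 𝓐) where
  open Frame 𝔽

  private
    Condition : Set₁
    Condition = World → Set

    Fm : ℕ → Set
    Fm = Formula (SetConst 𝓐)

    variable
      p q   : Condition
      e e'  : Vec Name n

  infix 3 _⊩ᵇ_[_] _⊩_[_]

  -- A holds throughout p, up to a settled part of p.  It is phrased with subsets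
  -- of p rather than with p ∩ ∁ A so that it is visibly inherited by subsets.
  Almost : Condition → (World → Set) → Set₁
  Almost p A = ∀ q → q ⊆ p → q ⊆ ∁ A → Settled q

  _⊩ᵇ_[_] : Condition → Fm n → Vec Name n → Set₁
  p ⊩ᵇ φ [ e ] = Almost p (True φ e)

  -- Atoms are read up to settled parts, falsum as 'settled', and ∨ and ∃ through
  -- their double negations.
  _⊩_[_] : Condition → Fm n → Vec Name n → Set₁
  p ⊩ t ≐ u   [ e ] = p ⊩ᵇ t ≐ u [ e ]
  p ⊩ t ≺ u   [ e ] = p ⊩ᵇ t ≺ u [ e ]
  p ⊩ t ∈̇ c   [ e ] = p ⊩ᵇ t ∈̇ c [ e ]
  p ⊩ ⊥̇       [ e ] = p ⊩ᵇ ⊥̇ [ e ]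
  p ⊩ φ ⇒ ψ   [ e ] = ∀ q → q ⊆ p → q ⊩ φ [ e ] → q ⊩ ψ [ e ]
  p ⊩ φ ∧̇ ψ   [ e ] = (p ⊩ φ [ e ]) × (p ⊩ ψ [ e ])
  p ⊩ φ ∨̇ ψ   [ e ] = ∀ q → q ⊆ p → (∀ r → r ⊆ q → r ⊩ φ [ e ] → Settled r) →
                      (∀ r → r ⊆ q → r ⊩ ψ [ e ] → Settled r) → Settled q
  p ⊩ ∀̇ φ     [ e ] = ∀ a → p ⊩ φ [ a ∷ e ]
  p ⊩ ∃̇ φ     [ e ] = ∀ q → q ⊆ p → (∀ r → r ⊆ q → ∀ a → r ⊩ φ [ a ∷ e ] → Settled r) →
                      Settled q

  Refutes : Condition → Fm n → Vec Name n → Set₁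
  Refutes p φ e = ∀ r → r ⊆ p → r ⊩ φ [ e ] → Settled r

  mono : ∀ (φ : Fm n) → q ⊆ p → p ⊩ φ [ e ] → q ⊩ φ [ e ]
  mono (t ≐ u) q⊆p f       = λ r r⊆q → f r (q⊆p ∘ r⊆q)
  mono (t ≺ u) q⊆p f       = λ r r⊆q → f r (q⊆p ∘ r⊆q)
  mono (t ∈̇ c) q⊆p f       = λ r r⊆q → f r (q⊆p ∘ r⊆q)
  mono ⊥̇       q⊆p f       = λ r r⊆q → f r (q⊆p ∘ r⊆q)
  mono (φ ⇒ ψ) q⊆p f       = λ r r⊆q → f r (q⊆p ∘ r⊆q)
  mono (φ ∧̇ ψ) q⊆p (f , g) = mono φ q⊆p f , mono ψ q⊆p g
  mono (φ ∨̇ ψ) q⊆p f       = λ r r⊆q → f r (q⊆p ∘ r⊆q)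
  mono (∀̇ φ)   q⊆p f       = λ a → mono φ q⊆p (f a)
  mono (∃̇ φ)   q⊆p f       = λ r r⊆q → f r (q⊆p ∘ r⊆q)

  ⊩⊥⇒settled : p ⊩ ⊥̇ [ e ] → Settled p
  ⊩⊥⇒settled f = f _ id (λ _ → id)

  -- The part of p on which the atom fails refutes it, hence is settled.
  stable-atom : ∀ {A : World → Set} →
                (∀ q → q ⊆ p → (∀ r → r ⊆ q → Almost r A → Settled r) → Settled q) → Almost p A
  stable-atom h q q⊆p q⊆¬A = h q q⊆p λ r r⊆q r⊩A → r⊩A r id (q⊆¬A ∘ r⊆q)

  -- Double negation elimination.  It also allows ∨ and ∃, which by themselves
  -- eliminate only into settledness, to be eliminated into any formula.
  stable : ∀ (φ : Fm n) → (∀ q → q ⊆ p → Refutes q φ e → Settled q) → p ⊩ φ [ e ]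
  stable (t ≐ u) h = stable-atom h
  stable (t ≺ u) h = stable-atom h
  stable (t ∈̇ c) h = stable-atom h
  stable ⊥̇       h = stable-atom h
  stable (φ ⇒ ψ) h q q⊆p q⊩φ = stable ψ λ r r⊆q ¬ψ →
    h r (q⊆p ∘ r⊆q) λ s s⊆r s⊩φ⇒ψ → ¬ψ s s⊆r (s⊩φ⇒ψ s id (mono φ (r⊆q ∘ s⊆r) q⊩φ))
  stable (φ ∧̇ ψ) h =
      stable φ (λ q q⊆p ¬φ → h q q⊆p λ r r⊆q (r⊩φ , _) → ¬φ r r⊆q r⊩φ)
    , stable ψ (λ q q⊆p ¬ψ → h q q⊆p λ r r⊆q (_ , r⊩ψ) → ¬ψ r r⊆q r⊩ψ)
  stable (φ ∨̇ ψ) h q q⊆p ¬φ ¬ψ = h q q⊆p λ r r⊆q r⊩φ∨ψ →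
    r⊩φ∨ψ r id (λ s s⊆r → ¬φ s (r⊆q ∘ s⊆r)) (λ s s⊆r → ¬ψ s (r⊆q ∘ s⊆r))
  stable (∀̇ φ) h a = stable φ λ q q⊆p ¬φ → h q q⊆p λ r r⊆q r⊩∀φ → ¬φ r r⊆q (r⊩∀φ a)
  stable (∃̇ φ) h q q⊆p ¬φ = h q q⊆p λ r r⊆q r⊩∃φ →
    r⊩∃φ r id λ s s⊆r → ¬φ s (r⊆q ∘ s⊆r)

  -- Renaming and substitution

  infix 2 _⟺_
  _⟺_ : Set₁ → Set₁ → Set₁
  A ⟺ B = (A → B) × (B → A)

  -- The equivalence is required at all subsets of p, as the clause for ⇒ needs it.
  Same : Condition → Fm m → Vec Name m → Fm n → Vec Name n → Set₁
  Same p φ e ψ e' = ∀ q → q ⊆ p → (q ⊩ φ [ e ]) ⟺ (q ⊩ ψ [ e' ])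

  same-atom : ∀ {A B : World → Set} → (∀ {w} → p w → B w ≡ A w) →
              ∀ q → q ⊆ p → Almost q A ⟺ Almost q B
  same-atom h q q⊆p =
      (λ f r r⊆q r⊆¬B → f r r⊆q λ w∈r a → r⊆¬B w∈r (subst id (sym (h (q⊆p (r⊆q w∈r)))) a))
    , (λ f r r⊆q r⊆¬A → f r r⊆q λ w∈r b → r⊆¬A w∈r (subst id (h (q⊆p (r⊆q w∈r))) b))

  same-⇒ : ∀ {φ ψ : Fm m} {φ' ψ' : Fm n} → Same p φ e φ' e' → Same p ψ e ψ' e' →
           Same p (φ ⇒ ψ) e (φ' ⇒ ψ') e'
  same-⇒ φ~ ψ~ q q⊆p =
      (λ f r r⊆q → proj₁ (ψ~ r (q⊆p ∘ r⊆q)) ∘ f r r⊆q ∘ proj₂ (φ~ r (q⊆p ∘ r⊆q)))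
    , (λ f r r⊆q → proj₂ (ψ~ r (q⊆p ∘ r⊆q)) ∘ f r r⊆q ∘ proj₁ (φ~ r (q⊆p ∘ r⊆q)))

  same-∧ : ∀ {φ ψ : Fm m} {φ' ψ' : Fm n} → Same p φ e φ' e' → Same p ψ e ψ' e' →
           Same p (φ ∧̇ ψ) e (φ' ∧̇ ψ') e'
  same-∧ φ~ ψ~ q q⊆p =
      (λ (f , g) → proj₁ (φ~ q q⊆p) f , proj₁ (ψ~ q q⊆p) g)
    , (λ (f , g) → proj₂ (φ~ q q⊆p) f , proj₂ (ψ~ q q⊆p) g)

  same-∨ : ∀ {φ ψ : Fm m} {φ' ψ' : Fm n} → Same p φ e φ' e' → Same p ψ e ψ' e' →
           Same p (φ ∨̇ ψ) e (φ' ∨̇ ψ') e'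
  same-∨ φ~ ψ~ q q⊆p =
      (λ f r r⊆q ¬φ ¬ψ → f r r⊆q (λ s s⊆r → ¬φ s s⊆r ∘ proj₁ (φ~ s (q⊆p ∘ r⊆q ∘ s⊆r)))
                               (λ s s⊆r → ¬ψ s s⊆r ∘ proj₁ (ψ~ s (q⊆p ∘ r⊆q ∘ s⊆r))))
    , (λ f r r⊆q ¬φ ¬ψ → f r r⊆q (λ s s⊆r → ¬φ s s⊆r ∘ proj₂ (φ~ s (q⊆p ∘ r⊆q ∘ s⊆r)))
                               (λ s s⊆r → ¬ψ s s⊆r ∘ proj₂ (ψ~ s (q⊆p ∘ r⊆q ∘ s⊆r))))

  same-∀ : ∀ {φ : Fm (suc m)} {ψ : Fm (suc n)} → (∀ a → Same p φ (a ∷ e) ψ (a ∷ e')) →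
           Same p (∀̇ φ) e (∀̇ ψ) e'
  same-∀ φ~ q q⊆p = (λ f a → proj₁ (φ~ a q q⊆p) (f a)) , (λ f a → proj₂ (φ~ a q q⊆p) (f a))

  same-∃ : ∀ {φ : Fm (suc m)} {ψ : Fm (suc n)} → (∀ a → Same p φ (a ∷ e) ψ (a ∷ e')) →
           Same p (∃̇ φ) e (∃̇ ψ) e'
  same-∃ φ~ q q⊆p =
      (λ f r r⊆q ¬ψ → f r r⊆q λ s s⊆r a → ¬ψ s s⊆r a ∘ proj₁ (φ~ a s (q⊆p ∘ r⊆q ∘ s⊆r)))
    , (λ f r r⊆q ¬φ → f r r⊆q λ s s⊆r a → ¬φ s s⊆r a ∘ proj₂ (φ~ a s (q⊆p ∘ r⊆q ∘ s⊆r)))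

  same-rename : ∀ (φ : Fm m) {r : Fin m → Fin n} →
                (∀ {w} → p w → ∀ i → lookup (at e' w) (r i) ≡ lookup (at e w) i) →
                Same p φ e (rename r φ) e'
  same-rename (t ≐ u) h = same-atom λ w∈p → cong₂ _≡_ (⟦rename⟧ (h w∈p) t) (⟦rename⟧ (h w∈p) u)
  same-rename (t ≺ u) h = same-atom λ w∈p → cong₂ _<_ (⟦rename⟧ (h w∈p) t) (⟦rename⟧ (h w∈p) u)
  same-rename (t ∈̇ c) h = same-atom λ {w} w∈p →
    cong (λ k → ⟦ modelAt w ⟧ₛ c k ≡ true) (⟦rename⟧ (h w∈p) t)
  same-rename ⊥̇       h = same-atom λ _ → refl
  same-rename (φ ⇒ ψ) h = same-⇒ (same-rename φ h) (same-rename ψ h)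
  same-rename (φ ∧̇ ψ) h = same-∧ (same-rename φ h) (same-rename ψ h)
  same-rename (φ ∨̇ ψ) h = same-∨ (same-rename φ h) (same-rename ψ h)
  same-rename (∀̇ φ)   h = same-∀ λ a → same-rename φ λ { w∈p zero → refl ; w∈p (suc i) → h w∈p i }
  same-rename (∃̇ φ)   h = same-∃ λ a → same-rename φ λ { w∈p zero → refl ; w∈p (suc i) → h w∈p i }

  -- The values of s and e have to agree on p only, not at all worlds: this is
  -- what replacing equals by equals on the part of p where they agree uses.
  same-substitute : ∀ (φ : Fm m) {s : Fin m → Term n} →
                    (∀ {w} → p w → ∀ i → ⟦ s i ⟧ (at e' w) ≡ lookup (at e w) i) →
                    Same p φ e (substitute s φ) e'
  same-substitute (t ≐ u) h = same-atom λ w∈p → cong₂ _≡_ (⟦subst⟧ (h w∈p) t) (⟦subst⟧ (h w∈p) u)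
  same-substitute (t ≺ u) h = same-atom λ w∈p → cong₂ _<_ (⟦subst⟧ (h w∈p) t) (⟦subst⟧ (h w∈p) u)
  same-substitute (t ∈̇ c) h = same-atom λ {w} w∈p →
    cong (λ k → ⟦ modelAt w ⟧ₛ c k ≡ true) (⟦subst⟧ (h w∈p) t)
  same-substitute ⊥̇       h = same-atom λ _ → refl
  same-substitute (φ ⇒ ψ) h = same-⇒ (same-substitute φ h) (same-substitute ψ h)
  same-substitute (φ ∧̇ ψ) h = same-∧ (same-substitute φ h) (same-substitute ψ h)
  same-substitute (φ ∨̇ ψ) h = same-∨ (same-substitute φ h) (same-substitute ψ h)
  same-substitute (∀̇ φ) {s} h = same-∀ λ a → same-substitute φ
    λ { w∈p zero → refl ; w∈p (suc i) → trans (⟦wk⟧ (s i)) (h w∈p i) }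
  same-substitute (∃̇ φ) {s} h = same-∃ λ a → same-substitute φ
    λ { w∈p zero → refl ; w∈p (suc i) → trans (⟦wk⟧ (s i)) (h w∈p i) }

  wk⇔ : ∀ (φ : Fm n) a → (p ⊩ φ [ e ]) ⟺ (p ⊩ wk φ [ a ∷ e ])
  wk⇔ φ a = same-rename φ (λ _ _ → refl) _ id

  inst⇔ : ∀ (φ : Fm (suc n)) t {a} → (∀ {w} → p w → value a w ≡ ⟦ t ⟧ (at e w)) →
          (p ⊩ φ [ a ∷ e ]) ⟺ (p ⊩ inst φ t [ e ])
  inst⇔ φ t h = same-substitute φ (λ { w∈p zero → sym (h w∈p) ; w∈p (suc i) → refl }) _ id

  -- Soundness of classical logic

  module _ {Θ : Sentence (SetConst 𝓐) → Set} (Θ-forced : ∀ {σ} → Θ σ → ∀ p → p ⊩ σ [ [] ]) where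

    weaken : ∀ {Γ : List (Fm n)} → q ⊆ p → All (λ ψ → p ⊩ ψ [ e ]) Γ → All (λ ψ → q ⊩ ψ [ e ]) Γ
    weaken q⊆p = All.map λ {ψ} → mono ψ q⊆p

    shift : ∀ {Γ : List (Fm n)} a → All (λ ψ → p ⊩ ψ [ e ]) Γ →
            All (λ ψ → p ⊩ ψ [ a ∷ e ]) (List.map wk Γ)
    shift a γ = All.map⁺ (All.map (λ {ψ} → proj₁ (wk⇔ ψ a)) γ)

    sound : ∀ {Γ : List (Fm n)} {φ} → Θ ∣ Γ ⊢ φ → ∀ p e →
            All (λ ψ → p ⊩ ψ [ e ]) Γ → p ⊩ φ [ e ]
    sound (axiom {σ = σ} σ∈Θ) p e γ = proj₁ (same-rename σ (λ _ ()) p id) (Θ-forced σ∈Θ p)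
    sound (assume φ∈Γ) p e γ = All.lookup γ φ∈Γ
    sound (raa {φ = φ} d) p e γ = stable φ λ q q⊆p ¬φ →
      ⊩⊥⇒settled {e = e} (sound d q e
        ((λ r r⊆q r⊩φ s s⊆r _ → ¬φ s (r⊆q ∘ s⊆r) (mono φ s⊆r r⊩φ)) ∷ weaken q⊆p γ))
    sound (⇒I d) p e γ = λ q q⊆p q⊩φ → sound d q e (q⊩φ ∷ weaken q⊆p γ)
    sound (⇒E d d') p e γ = sound d p e γ p id (sound d' p e γ)
    sound (∧I d d') p e γ = sound d p e γ , sound d' p e γ
    sound (∧E₁ d) p e γ = proj₁ (sound d p e γ)
    sound (∧E₂ d) p e γ = proj₂ (sound d p e γ)
    sound (∨I₁ {φ = φ} d) p e γ = λ q q⊆p ¬φ ¬ψ → ¬φ q id (mono φ q⊆p (sound d p e γ))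
    sound (∨I₂ {ψ = ψ} d) p e γ = λ q q⊆p ¬φ ¬ψ → ¬ψ q id (mono ψ q⊆p (sound d p e γ))
    sound (∨E {χ = χ} d d₁ d₂) p e γ = stable χ λ q q⊆p ¬χ → sound d p e γ q q⊆p
      (λ r r⊆q r⊩φ → ¬χ r r⊆q (sound d₁ r e (r⊩φ ∷ weaken (q⊆p ∘ r⊆q) γ)))
      (λ r r⊆q r⊩ψ → ¬χ r r⊆q (sound d₂ r e (r⊩ψ ∷ weaken (q⊆p ∘ r⊆q) γ)))
    sound (∀I d) p e γ = λ a → sound d p (a ∷ e) (shift a γ)
    sound (∀E {φ = φ} d t) p e γ =
      let a , a≡t = termName t e in proj₁ (inst⇔ φ t (λ _ → a≡t _)) (sound d p e γ a)
    sound (∃I {φ = φ} t d) p e γ = λ q q⊆p ¬φ →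
      let a , a≡t = termName t e
      in ¬φ q id a (mono φ q⊆p (proj₂ (inst⇔ φ t (λ _ → a≡t _)) (sound d p e γ)))
    sound (∃E {χ = χ} d d') p e γ = stable χ λ q q⊆p ¬χ → sound d p e γ q q⊆p
      λ r r⊆q a r⊩φ → ¬χ r r⊆q
        (proj₂ (wk⇔ χ a) (sound d' r (a ∷ e) (r⊩φ ∷ shift a (weaken (q⊆p ∘ r⊆q) γ))))
    sound (≐I t) p e γ = λ q q⊆p t≢t → settled-⊆ (λ w∈q → t≢t w∈q refl) settled-∅
    sound (≐E φ {t} {u} d d') p e γ = stable (inst φ u) λ q q⊆p ¬φu →
      let a , a≡t = termName t e
      -- Where t = u holds, the same name a denotes both terms; the remaining part
      -- of q is settled because t = u is forced.
      in split (t ≐ u) e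
           (¬φu _ proj₁
             (proj₁ (inst⇔ φ u (λ {w} (_ , t≡u) → trans (a≡t w) t≡u))
               (mono φ (q⊆p ∘ proj₁) (proj₂ (inst⇔ φ t (λ {w} _ → a≡t w)) (sound d' p e γ)))))
           (sound d p e γ _ (q⊆p ∘ proj₁) proj₂)

  -- Bounded formulas and the axioms under forcing

  certain : ∀ {A : World → Set} → p ⊆ A → Almost p A
  certain p⊆A q q⊆p q⊆¬A = settled-⊆ (λ w∈q → q⊆¬A w∈q (p⊆A (q⊆p w∈q))) settled-∅

  -- For bounded formulas, forcing is truth up to a settled part.  The two
  -- directions use each other at implications.  A bounded quantifier is tested at
  -- one chosen name: a counterexample below the bound for ∀, a witness for ∃.
  bounded⁻ : ∀ {φ : Fm n} → Bounded φ → p ⊩ φ [ e ] → p ⊩ᵇ φ [ e ]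
  bounded⁺ : ∀ {φ : Fm n} → Bounded φ → p ⊩ᵇ φ [ e ] → p ⊩ φ [ e ]

  bounded⁻ (t ≐ u) f = f
  bounded⁻ (t ≺ u) f = f
  bounded⁻ (t ∈̇ c) f = f
  bounded⁻ ⊥̇       f = f
  bounded⁻ (b ⇒ c) f q q⊆p q⊆¬φ⇒ψ =
    bounded⁻ c
      (f q q⊆p (bounded⁺ b λ r r⊆q r⊆¬φ → settled-⊆
        (λ w∈r → q⊆¬φ⇒ψ (r⊆q w∈r) (⊥-elim ∘ r⊆¬φ w∈r)) settled-∅))
      q id (λ w∈q ψ-true → q⊆¬φ⇒ψ w∈q λ _ → ψ-true)
  bounded⁻ {e = e} (b ∧̇ c) (f , g) q q⊆p q⊆¬φ∧ψ = split b e
    (bounded⁻ c g _ (q⊆p ∘ proj₁) λ (w∈q , φ-true) ψ-true → q⊆¬φ∧ψ w∈q (φ-true , ψ-true))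
    (bounded⁻ b f _ (q⊆p ∘ proj₁) proj₂)
  bounded⁻ (b ∨̇ c) f q q⊆p q⊆¬φ∨ψ = f q q⊆p
    (λ r r⊆q r⊩φ → bounded⁻ b r⊩φ r id λ w∈r → q⊆¬φ∨ψ (r⊆q w∈r) ∘ inj₁)
    (λ r r⊆q r⊩ψ → bounded⁻ c r⊩ψ r id λ w∈r → q⊆¬φ∨ψ (r⊆q w∈r) ∘ inj₂)
  bounded⁻ {e = e} (all< t b) f q q⊆p q⊆¬∀ =
    let a , a-chosen = choose t (b ⇒ ⊥̇) e
        counterexample = λ {w} w∈q → a-chosen (¬all⇒ex¬ ⟦ modelAt w ⟧ₛ t b (at e w) (q⊆¬∀ w∈q))
    in bounded⁻ b (f a q q⊆p (certain (proj₁ ∘ counterexample))) q id (proj₂ ∘ counterexample)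
  bounded⁻ {e = e} (ex< t b) f q q⊆p q⊆¬∃ = f q q⊆p λ r r⊆q a (r⊩a<t , r⊩φ) →
    split (x₀ ≺ wkₜ t) (a ∷ e)
      (bounded⁻ b r⊩φ _ proj₁ λ (w∈r , a<t) φ-true → q⊆¬∃ (r⊆q w∈r) (_ , a<t , φ-true))
      (r⊩a<t _ proj₁ proj₂)

  bounded⁺ (t ≐ u) f = f
  bounded⁺ (t ≺ u) f = f
  bounded⁺ (t ∈̇ c) f = f
  bounded⁺ ⊥̇       f = f
  bounded⁺ {e = e} (b ⇒ c) f q q⊆p q⊩φ = bounded⁺ c λ r r⊆q r⊆¬ψ → split b e
    (f _ (q⊆p ∘ r⊆q ∘ proj₁) λ (w∈r , φ-true) φ⇒ψ → r⊆¬ψ w∈r (φ⇒ψ φ-true))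
    (bounded⁻ b q⊩φ _ (r⊆q ∘ proj₁) proj₂)
  bounded⁺ (b ∧̇ c) f =
      bounded⁺ b (λ q q⊆p q⊆¬φ → f q q⊆p λ w∈q → q⊆¬φ w∈q ∘ proj₁)
    , bounded⁺ c (λ q q⊆p q⊆¬ψ → f q q⊆p λ w∈q → q⊆¬ψ w∈q ∘ proj₂)
  bounded⁺ {e = e} (b ∨̇ c) f q q⊆p ¬φ ¬ψ = split b e
    (¬φ _ proj₁ (bounded⁺ b (certain proj₂)))
    (split c e
      (¬ψ _ (proj₁ ∘ proj₁) (bounded⁺ c (certain proj₂)))
      (f _ (q⊆p ∘ proj₁ ∘ proj₁) λ { ((_ , φ-false) , _) (inj₁ φ-true) → φ-false φ-true
                                    ; (_ , ψ-false) (inj₂ ψ-true) → ψ-false ψ-true }))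
  bounded⁺ {e = e} (all< t b) f a q q⊆p q⊩a<t = bounded⁺ b λ r r⊆q r⊆¬φ →
    split (x₀ ≺ wkₜ t) (a ∷ e)
      (f _ (q⊆p ∘ r⊆q ∘ proj₁) λ (w∈r , a<t) all → r⊆¬φ w∈r (all _ a<t))
      (q⊩a<t _ (r⊆q ∘ proj₁) proj₂)
  bounded⁺ {e = e} (ex< t b) f q q⊆p ¬∃ =
    let a , a-chosen = choose t b e
    in split (ex< t b) e
         (¬∃ _ proj₁ a ( certain (λ (_ , ex) → proj₁ (a-chosen ex))
                       , bounded⁺ b (certain λ (_ , ex) → proj₂ (a-chosen ex))))
         (f _ (q⊆p ∘ proj₁) proj₂)

  Π⁺ : ∀ {φ : Fm n} → Π⁰₁ φ → p ⊆ True φ e → p ⊩ φ [ e ]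
  Π⁺ (bounded b) h = bounded⁺ b (certain h)
  Π⁺ (∀̇ π)       h = λ a → Π⁺ π λ w∈p → h w∈p _

  -- A forced Σ⁰₁ formula may be assumed true in order to show p settled: the
  -- forced existential quantifiers provide names, and the bounded matrix is
  -- decided by them.
  Σ⁻ : ∀ {φ : Fm n} → Σ⁰₁ φ → p ⊩ φ [ e ] → (∀ q → q ⊆ p → q ⊆ True φ e → Settled q) → Settled p
  Σ⁻ {e = e} (bounded b) f h = split b e (h _ proj₁ proj₂) (bounded⁻ b f _ proj₁ proj₂)
  Σ⁻ (∃̇ σ) f h = f _ id λ r r⊆p a r⊩φ →
    Σ⁻ σ r⊩φ λ q q⊆r q⊆φ → h q (r⊆p ∘ q⊆r) λ w∈q → _ , q⊆φ w∈q

  -- The totality of f_d is the one axiom that is not universal; its witness is the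
  -- name of the image under f_d.
  axiom-forced : ∀ {σ} → RA₁ 𝓐 σ → ∀ p → p ⊩ σ [ [] ]
  axiom-forced ax@(basic σ∈)   p = Π⁺ (All.lookup BASIC-Π⁰₁ σ∈) λ {w} _ → isModel (modelAt w) ax
  axiom-forced ax@(defining d) p = Π⁺ (definingAxiom-Π⁰₁ d) λ {w} _ → isModel (modelAt w) ax
  axiom-forced ax@(total d)    p =
      (λ a q q⊆p ¬∃ → let b , b-image = imageName d a in ¬∃ q id b (certain λ {w} _ → b-image w))
    , Π⁺ {e = []} (∀̇ ∀̇ ∀̇ bounded (((⟪ x₀ , x₁ ⟫ ∈̇ 𝐟 d) ∧̇ (⟪ x₀ , x₂ ⟫ ∈̇ 𝐟 d)) ⇒ (x₁ ≐ x₂)))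
         (λ {w} _ → proj₁ (proj₂ (isModel (modelAt w) ax)))
    , Π⁺ {e = []} (bounded ((`0 ∈̇ 𝐟 d) ⇒ ⊥̇)) (λ {w} _ → proj₂ (proj₂ (isModel (modelAt w) ax)))

  theorem-forced : ∀ {σ} → RA₁ 𝓐 ∣ [] ⊢ σ → ∀ p → p ⊩ σ [ [] ]
  theorem-forced d p = sound axiom-forced d p [] []

-- Uniqueness in a standard model

module _ {O : Subset} (M : StandardModel 𝓐 O) where

  -- Forcing over this frame amounts to the negative translation of truth in M.
  pointFrame : Frame 𝓐
  pointFrame = record
    { World     = ⊤
    ; Name      = ℕ
    ; oracleAt  = λ _ → O
    ; modelAt   = λ _ → M
    ; value     = λ a _ → a
    ; Settled   = λ p → ¬ p tt
    ; settled-⊆ = λ q⊆p ¬p → ¬p ∘ q⊆p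
    ; settled-∅ = id
    ; split     = λ b e s s' w∈p → s' (w∈p , λ φ-true → s (w∈p , φ-true))
    ; termName  = λ t e → _ , λ _ → refl
    ; imageName = λ d a → let b , ab∈d = proj₁ (isModel M (total d)) a in b , λ _ → ab∈d
    ; choose    = choose
    }
    where
    choose : ∀ (t : Term n) {φ} → Bounded φ → ∀ (e : Vec ℕ n) → let ρ = map (λ a → a) e in
             ∃ λ a → {_ : ⊤} → ⟦ M ⟧ₛ ⊨ ∃<̇ t φ [ ρ ] → ⟦ M ⟧ₛ ⊨ x₀ ≺ wkₜ t ∧̇ φ [ a ∷ ρ ]
    choose t b e with bounded? ⟦ M ⟧ₛ (ex< t b) (map (λ a → a) e)
    ... | yes (a , h) = a , λ _ → h
    ... | no  ¬ex     = 0 , λ ex → contradiction ex ¬ex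

  open Forcing pointFrame
  open Frame pointFrame using (True)

  -- Numbers name themselves, so that a true Σ⁰₁ formula has named witnesses.
  Σ⁺ : ∀ {φ : Formula (SetConst 𝓐) n} → Σ⁰₁ φ → ∀ {p e} → True φ e tt → p ⊩ φ [ e ]
  Σ⁺ (bounded b) h       = bounded⁺ b (certain λ _ → h)
  Σ⁺ (∃̇ σ)       (a , h) = λ q q⊆p ¬φ → ¬φ q id a (Σ⁺ σ h)

  -- Equality of numbers is decidable, so that its double negation, which is what
  -- forcing yields, suffices.
  provably-unique : ∀ {φ} → Σ⁰₁ φ → RA₁ 𝓐 ∣ [] ⊢ ∀̇ ∃!̇ φ → ∀ {x y y'} →
                    ⟦ M ⟧ₛ ⊨ φ [ y ∷ x ∷ [] ] → ⟦ M ⟧ₛ ⊨ φ [ y' ∷ x ∷ [] ] → y ≡ y'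
  provably-unique {φ} σ ⊢∃! {x} {y} {y'} φy φy' = decidable-stable (y ≟ y') λ y≢y' →
    theorem-forced ⊢∃! (λ _ → ⊤) x (λ _ → ⊤) id
      (λ r _ z (_ , uniq) w∈r → y≢y' (trans (unique r z uniq w∈r φy) (sym (unique r z uniq w∈r φy'))))
      tt
    where
    unique : ∀ r z → r ⊩ ∀̇ (rename (liftᵣ suc) φ ⇒ x₀ ≐ x₁) [ z ∷ x ∷ [] ] → r tt →
             ∀ {y} → ⟦ M ⟧ₛ ⊨ φ [ y ∷ x ∷ [] ] → y ≡ z
    unique r z uniq w∈r {y} φy = decidable-stable (y ≟ z) λ y≢z →
      uniq y r id
        (proj₁ (same-rename φ {r = liftᵣ suc} (λ { _ zero → refl ; _ (suc zero) → refl }) r id)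
          (Σ⁺ σ {e = y ∷ x ∷ []} φy))
        r id (λ _ → y≢z) w∈r

-- The arithmetic of derivations

Indicates : Set → ℕ → Set
Indicates A v = (A × v ≡ 1) ⊎ (¬ A × v ≡ 0)

indicates-map : ∀ {A B : Set} {v} → (A → B) → (B → A) → Indicates A v → Indicates B v
indicates-map f g (inj₁ (a , v≡1))  = inj₁ (f a , v≡1)
indicates-map f g (inj₂ (¬a , v≡0)) = inj₂ (¬a ∘ g , v≡0)

indicates-≡ : ∀ {A : Set} {v w} → v ≡ w → Indicates A w → Indicates A v
indicates-≡ refl ind = ind

indicates-1 : ∀ {A : Set} {v} → Indicates A v → v ≡ 1 → A
indicates-1 (inj₁ (a , _)) _ = a
indicates-1 (inj₂ (_ , refl)) ()

indicates-0 : ∀ {A : Set} {v} → Indicates A v → ¬ A → v ≡ 0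
indicates-0 (inj₁ (a , _))   ¬a = contradiction a ¬a
indicates-0 (inj₂ (_ , v≡0)) _  = v≡0

1-indicates : ∀ {A : Set} {v} → Indicates A v → A → v ≡ 1
1-indicates (inj₁ (_ , v≡1)) _ = v≡1
1-indicates (inj₂ (¬a , _))  a = contradiction a ¬a

module Algebra (𝓐 : AlgebraClass) where

  private
    Deriv : Set
    Deriv = Derivation 𝓐

    required : ∀ k → List.lookup requiredOps k ∈ operators 𝓐
    required k = hasRequired 𝓐 (∈-lookup {xs = requiredOps} k)

  -- An operator is applied through its membership in the class, as the index of
  -- a required operator depends on the class.
  applyOp : ∀ {o} → o ∈ operators 𝓐 → Vec Deriv (arity o) → Deriv
  applyOp o∈ ds = apply (index o∈) (subst (Vec Deriv ∘ arity) (lookup-index o∈) ds)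

  sucᵈ plusᵈ timesᵈ lessᵈ idᵈ condᵈ : Deriv
  sucᵈ   = applyOp (required (# 0)) []
  plusᵈ  = applyOp (required (# 1)) []
  timesᵈ = applyOp (required (# 2)) []
  lessᵈ  = applyOp (required (# 3)) []
  idᵈ    = applyOp (required (# 4)) []
  condᵈ  = applyOp (required (# 5)) []

  infixr 9 _∘ᵈ_

  pairᵈ _∘ᵈ_ : Deriv → Deriv → Deriv
  pairᵈ g h = applyOp (required (# 6)) (g ∷ h ∷ [])
  g ∘ᵈ h    = applyOp (required (# 7)) (g ∷ h ∷ [])

  μᵈ : Deriv → Deriv
  μᵈ g = applyOp (required (# 8)) (g ∷ [])

  -- The argument x itself serves as the pair (y , z) in D(c , y , z), which turns
  -- the conditional into the two projections: D(0 , x) is the first component of x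
  -- and D(1 , x) is the second one; at x = 0 both are 0.
  zeroᵈ oneᵈ headᵈ tailᵈ : Deriv
  zeroᵈ = lessᵈ ∘ᵈ pairᵈ idᵈ idᵈ
  oneᵈ  = sucᵈ ∘ᵈ zeroᵈ
  headᵈ = condᵈ ∘ᵈ pairᵈ zeroᵈ idᵈ
  tailᵈ = condᵈ ∘ᵈ pairᵈ oneᵈ idᵈ

  -- D returns its second argument at 0, so that the branch for truth comes last.
  ifᵈ : Deriv → Deriv → Deriv → Deriv
  ifᵈ c a b = condᵈ ∘ᵈ pairᵈ c (pairᵈ b a)

  notᵈ : Deriv → Deriv
  notᵈ c = ifᵈ c zeroᵈ oneᵈ

  infix 8 _<ᵈ_ _≡ᵈ_

  _<ᵈ_ _≡ᵈ_ : Deriv → Deriv → Deriv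
  a <ᵈ b = lessᵈ ∘ᵈ pairᵈ a b
  a ≡ᵈ b = ifᵈ (a <ᵈ b) zeroᵈ (notᵈ (b <ᵈ a))

  termᵈ : Term n → Vec Deriv n → Deriv
  termᵈ (var i)   e = lookup e i
  termᵈ `0        e = zeroᵈ
  termᵈ (`S t)    e = sucᵈ ∘ᵈ termᵈ t e
  termᵈ (`H t)    e = headᵈ ∘ᵈ termᵈ t e
  termᵈ (`T t)    e = tailᵈ ∘ᵈ termᵈ t e
  termᵈ (t `+ u)  e = plusᵈ ∘ᵈ pairᵈ (termᵈ t e) (termᵈ u e)
  termᵈ (t `· u)  e = timesᵈ ∘ᵈ pairᵈ (termᵈ t e) (termᵈ u e)
  termᵈ ⟪ t , u ⟫ e = pairᵈ (termᵈ t e) (termᵈ u e)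

  -- z belongs to the graph of f_d if z is a pair with f_d(H(z)) = T(z); that z is
  -- a pair has to be tested, since H(0) = T(0) = 0.
  memberᵈ : SetConst 𝓐 → Deriv
  memberᵈ 𝐗     = X⋆
  memberᵈ (𝐟 d) = ifᵈ (zeroᵈ <ᵈ idᵈ) (d ∘ᵈ headᵈ ≡ᵈ tailᵈ) zeroᵈ

  -- A derivation has a single argument, so that below a bounded quantifier the
  -- quantified number z is stored together with the old argument x as (z , x).
  under : Vec Deriv n → Vec Deriv (suc n)
  under e = headᵈ ∷ map (_∘ᵈ tailᵈ) e

  -- At x: the least z < t(x) with g(z , x) = 1, and t(x) if there is none.
  searchᵈ : Deriv → Deriv → Deriv
  searchᵈ g t = μᵈ g ∘ᵈ pairᵈ t idᵈ

  charᵈ : {φ : Formula (SetConst 𝓐) n} → Bounded φ → Vec Deriv n → Deriv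
  charᵈ (t ≐ u)    e = termᵈ t e ≡ᵈ termᵈ u e
  charᵈ (t ≺ u)    e = termᵈ t e <ᵈ termᵈ u e
  charᵈ (t ∈̇ c)    e = memberᵈ c ∘ᵈ termᵈ t e
  charᵈ ⊥̇          e = zeroᵈ
  charᵈ (b ⇒ c)    e = ifᵈ (charᵈ b e) (charᵈ c e) oneᵈ
  charᵈ (b ∧̇ c)    e = ifᵈ (charᵈ b e) (charᵈ c e) zeroᵈ
  charᵈ (b ∨̇ c)    e = ifᵈ (charᵈ b e) oneᵈ (charᵈ c e)
  charᵈ (all< t b) e = notᵈ (searchᵈ (notᵈ (charᵈ b (under e))) (termᵈ t e) <ᵈ termᵈ t e)
  charᵈ (ex< t b)  e = searchᵈ (charᵈ b (under e)) (termᵈ t e) <ᵈ termᵈ t e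

  module Values {O : Subset} (M : StandardModel 𝓐 O) where

    val : Deriv → ℕ → ℕ
    val d x = proj₁ (proj₁ (isModel M (total d)) x)

    val-∈ : ∀ d x → sets M d (pair x (val d x)) ≡ true
    val-∈ d x = proj₂ (proj₁ (isModel M (total d)) x)

    ∈⇒val≡ : ∀ d {x y} → sets M d (pair x y) ≡ true → val d x ≡ y
    ∈⇒val≡ d {x} {y} xy∈d = proj₁ (proj₂ (isModel M (total d))) y (val d x) x (val-∈ d x , xy∈d)

    applyOp-holds : ∀ {o} (o∈ : o ∈ operators 𝓐) ds →
                    ⟦ M ⟧ₛ ⊨ mapSet (constants (applyOp o∈ ds) ds) (definition o)
    applyOp-holds o∈ = holds (index o∈) (lookup-index o∈)
      where
      holds : ∀ i {o} (eq : o ≡ op 𝓐 i) (ds : Vec Deriv (arity o)) →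
              ⟦ M ⟧ₛ ⊨ mapSet (constants (apply i (subst (Vec Deriv ∘ arity) eq ds)) ds) (definition o)
      holds i refl ds = isModel M (defining (apply i ds))

    val-suc : ∀ x → val sucᵈ x ≡ suc x
    val-suc x = ∈⇒val≡ sucᵈ (applyOp-holds (required (# 0)) [] x)

    val-plus : ∀ x y → val plusᵈ (pair x y) ≡ x + y
    val-plus x y = ∈⇒val≡ plusᵈ (proj₁ (applyOp-holds (required (# 1)) [] y x))

    val-times : ∀ x y → val timesᵈ (pair x y) ≡ x * y
    val-times x y = ∈⇒val≡ timesᵈ (proj₁ (applyOp-holds (required (# 2)) [] y x))

    val-less : ∀ x y → Indicates (x < y) (val lessᵈ (pair x y))
    val-less x y = by-cases (x <? y)
      where
      holds = applyOp-holds (required (# 3)) [] y x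
      by-cases : Dec (x < y) → Indicates (x < y) (val lessᵈ (pair x y))
      by-cases (yes x<y) = inj₁ (x<y , ∈⇒val≡ lessᵈ (proj₁ holds x<y))
      by-cases (no x≮y)  =
        inj₂ (x≮y , ∈⇒val≡ lessᵈ (proj₁ (proj₂ holds) (m≤n⇒m<n∨m≡n (≮⇒≥ x≮y))))

    val-id : ∀ x → val idᵈ x ≡ x
    val-id x = ∈⇒val≡ idᵈ (applyOp-holds (required (# 4)) [] x)

    val-cond-0 : ∀ y z → val condᵈ (pair 0 (pair y z)) ≡ y
    val-cond-0 y z = ∈⇒val≡ condᵈ (proj₁ (applyOp-holds (required (# 5)) [] z y 0))

    val-cond-suc : ∀ x y z → val condᵈ (pair (suc x) (pair y z)) ≡ z
    val-cond-suc x y z = ∈⇒val≡ condᵈ (proj₁ (proj₂ (applyOp-holds (required (# 5)) [] z y x)))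

    val-cond-nonpair : ∀ x → val condᵈ (pair x 0) ≡ 0
    val-cond-nonpair x =
      ∈⇒val≡ condᵈ (proj₂ (proj₂ (proj₂ (applyOp-holds (required (# 5)) [] 0 0 x))))

    val-pair : ∀ g h {x v w} → val g x ≡ v → val h x ≡ w → val (pairᵈ g h) x ≡ pair v w
    val-pair g h {x} refl refl = ∈⇒val≡ (pairᵈ g h)
      (applyOp-holds (required (# 6)) (g ∷ h ∷ []) _ _ x (val-∈ g x , val-∈ h x))

    val-∘ : ∀ g h {x y} → val h x ≡ y → val (g ∘ᵈ h) x ≡ val g y
    val-∘ g h {x} refl = ∈⇒val≡ (g ∘ᵈ h)
      (applyOp-holds (required (# 7)) (g ∷ h ∷ []) _ _ x (val-∈ h x , val-∈ g (val h x)))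

    -- The search is bounded by b, so that ending below b means success.
    val-μ : ∀ g b x → let z = val (μᵈ g) (pair b x) in
            (z < b → val g (pair z x) ≡ 1) × (∀ y → y < b → val g (pair y x) ≡ 1 → z < b)
    val-μ g b x =
        (λ z<b → ∈⇒val≡ g (proj₁ (proj₂ (proj₂ (holds 0))) (z∈ , z<b)))
      , λ y y<b gy≡1 → ≤-<-trans
          (≼⇒≤ (proj₁ (proj₂ (holds y))
            (z∈ , y<b , subst (λ v → sets M g (pair (pair y x) v) ≡ true) gy≡1 (val-∈ g (pair y x)))))
          y<b
      where
      z∈ = val-∈ (μᵈ g) (pair b x)
      holds = λ y → applyOp-holds (required (# 8)) (g ∷ []) (val (μᵈ g) (pair b x)) y x b
      ≼⇒≤ : ∀ {z y} → z < y ⊎ z ≡ y → z ≤ y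
      ≼⇒≤ (inj₁ z<y)  = <⇒≤ z<y
      ≼⇒≤ (inj₂ refl) = ≤-refl

    val-∘-pair : ∀ f g h {x v w} → val g x ≡ v → val h x ≡ w →
                 val (f ∘ᵈ pairᵈ g h) x ≡ val f (pair v w)
    val-∘-pair f g h p q = val-∘ f (pairᵈ g h) (val-pair g h p q)

    val-< : ∀ a b x → Indicates (val a x < val b x) (val (a <ᵈ b) x)
    val-< a b x = indicates-≡ (val-∘-pair lessᵈ a b refl refl) (val-less (val a x) (val b x))

    val-zero : ∀ x → val zeroᵈ x ≡ 0
    val-zero x = indicates-0 (val-< idᵈ idᵈ x) (<-irrefl refl)

    val-one : ∀ x → val oneᵈ x ≡ 1
    val-one x = trans (val-∘ sucᵈ zeroᵈ (val-zero x)) (val-suc 0)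

    pair-cases : ∀ (Q : ℕ → Set) → Q 0 → (∀ x y → Q (pair x y)) → ∀ z → Q z
    pair-cases Q q₀ q zero    = q₀
    pair-cases Q q₀ q (suc n) =
      let x , _ , y , _ , xy≡z = pair-surjective (suc n) (s≤s z≤n) in subst Q xy≡z (q x y)

    val-head : ∀ x → val headᵈ x ≡ head x
    val-head x = trans (val-∘-pair condᵈ zeroᵈ idᵈ (val-zero x) (val-id x))
      (pair-cases (λ x → val condᵈ (pair 0 x) ≡ head x) (val-cond-nonpair 0)
        (λ y z → trans (val-cond-0 y z) (sym (head-pair y z))) x)

    val-tail : ∀ x → val tailᵈ x ≡ tail x
    val-tail x = trans (val-∘-pair condᵈ oneᵈ idᵈ (val-one x) (val-id x))
      (pair-cases (λ x → val condᵈ (pair 1 x) ≡ tail x) (val-cond-nonpair 1)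
        (λ y z → trans (val-cond-suc 0 y z) (sym (tail-pair y z))) x)

    val-if-1 : ∀ c a b {x} → val c x ≡ 1 → val (ifᵈ c a b) x ≡ val a x
    val-if-1 c a b c≡1 =
      trans (val-∘-pair condᵈ c (pairᵈ b a) c≡1 (val-pair b a refl refl)) (val-cond-suc 0 (val b _) (val a _))

    val-if-0 : ∀ c a b {x} → val c x ≡ 0 → val (ifᵈ c a b) x ≡ val b x
    val-if-0 c a b c≡0 =
      trans (val-∘-pair condᵈ c (pairᵈ b a) c≡0 (val-pair b a refl refl)) (val-cond-0 (val b _) (val a _))

    indicates-if : ∀ c a b {x} {A B : Set} → Indicates A (val c x) →
                   (A → Indicates B (val a x)) → (¬ A → Indicates B (val b x)) →
                   Indicates B (val (ifᵈ c a b) x)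
    indicates-if c a b (inj₁ (p , c≡1))  f g = indicates-≡ (val-if-1 c a b c≡1) (f p)
    indicates-if c a b (inj₂ (¬p , c≡0)) f g = indicates-≡ (val-if-0 c a b c≡0) (g ¬p)

    indicates-zero : ∀ {x} {A : Set} → ¬ A → Indicates A (val zeroᵈ x)
    indicates-zero ¬p = inj₂ (¬p , val-zero _)

    indicates-one : ∀ {x} {A : Set} → A → Indicates A (val oneᵈ x)
    indicates-one p = inj₁ (p , val-one _)

    indicates-not : ∀ c {x} {A : Set} → Indicates A (val c x) → Indicates (¬ A) (val (notᵈ c) x)
    indicates-not c ind = indicates-if c zeroᵈ oneᵈ ind
      (λ p → indicates-zero λ ¬p → ¬p p) (λ ¬p → indicates-one ¬p)

    val-≡ : ∀ a b x → Indicates (val a x ≡ val b x) (val (a ≡ᵈ b) x)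
    val-≡ a b x = indicates-if (a <ᵈ b) zeroᵈ (notᵈ (b <ᵈ a)) (val-< a b x)
      (λ a<b → indicates-zero λ a≡b → <-irrefl a≡b a<b)
      (λ a≮b → indicates-map (λ b≮a → ≤-antisym (≮⇒≥ b≮a) (≮⇒≥ a≮b))
                 (λ a≡b b<a → <-irrefl (sym a≡b) b<a)
                 (indicates-not (b <ᵈ a) (val-< b a x)))

    at : Vec Deriv n → ℕ → Vec ℕ n
    at e x = map (λ d → val d x) e

    val-term : ∀ (t : Term n) e x → val (termᵈ t e) x ≡ ⟦ t ⟧ (at e x)
    val-term (var i)   e x = sym (lookup-map i (λ d → val d x) e)
    val-term `0        e x = val-zero x
    val-term (`S t)    e x = trans (val-∘ sucᵈ (termᵈ t e) (val-term t e x)) (val-suc _)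
    val-term (`H t)    e x = trans (val-∘ headᵈ (termᵈ t e) (val-term t e x)) (val-head _)
    val-term (`T t)    e x = trans (val-∘ tailᵈ (termᵈ t e) (val-term t e x)) (val-tail _)
    val-term (t `+ u)  e x =
      trans (val-∘-pair plusᵈ (termᵈ t e) (termᵈ u e) (val-term t e x) (val-term u e x))
            (val-plus (⟦ t ⟧ (at e x)) (⟦ u ⟧ (at e x)))
    val-term (t `· u)  e x =
      trans (val-∘-pair timesᵈ (termᵈ t e) (termᵈ u e) (val-term t e x) (val-term u e x))
            (val-times (⟦ t ⟧ (at e x)) (⟦ u ⟧ (at e x)))
    val-term ⟪ t , u ⟫ e x = val-pair (termᵈ t e) (termᵈ u e) (val-term t e x) (val-term u e x)

    val-member : ∀ c x → Indicates (⟦ M ⟧ₛ c x ≡ true) (val (memberᵈ c) x)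
    val-member 𝐗 x with O x Bool.≟ true | isModel M (defining X⋆) x
    ... | yes x∈O | in-O , _  = inj₁ (x∈O , ∈⇒val≡ X⋆ (in-O x∈O))
    ... | no  x∉O | _ , out-O = inj₂ (x∉O , ∈⇒val≡ X⋆ (out-O x∉O))
    val-member (𝐟 d) = pair-cases _
      (indicates-if (zeroᵈ <ᵈ idᵈ) equal zeroᵈ (val-< zeroᵈ idᵈ 0)
        (λ 0<0 → contradiction (subst₂ _<_ (val-zero 0) (val-id 0) 0<0) (<-irrefl refl))
        (λ _ → indicates-zero (proj₂ (proj₂ (isModel M (total d))))))
      (λ x y → let z = pair x y in
        indicates-if (zeroᵈ <ᵈ idᵈ) equal zeroᵈ (val-< zeroᵈ idᵈ z)
          (λ _ → indicates-map
            (λ dx≡y → subst (λ y → sets M d (pair x y) ≡ true)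
              (trans (sym (val-dx z x (head-pair x y))) (trans dx≡y (val-y x y))) (val-∈ d x))
            (λ z∈d → trans (val-dx z x (head-pair x y)) (trans (∈⇒val≡ d z∈d) (sym (val-y x y))))
            (val-≡ (d ∘ᵈ headᵈ) tailᵈ z))
          (λ z≯0 → contradiction (subst₂ _<_ (sym (val-zero z)) (sym (val-id z)) (s≤s z≤n)) z≯0))
      where
      equal = d ∘ᵈ headᵈ ≡ᵈ tailᵈ

      val-dx : ∀ z x → head z ≡ x → val (d ∘ᵈ headᵈ) z ≡ val d x
      val-dx z x eq = val-∘ d headᵈ (trans (val-head z) eq)

      val-y : ∀ x y → val tailᵈ (pair x y) ≡ y
      val-y x y = trans (val-tail (pair x y)) (tail-pair x y)

    at-under : ∀ (e : Vec Deriv n) z x → at (under e) (pair z x) ≡ z ∷ at e x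
    at-under e z x = cong₂ _∷_ (trans (val-head (pair z x)) (head-pair z x))
      (trans (sym (map-∘ (λ d → val d (pair z x)) (_∘ᵈ tailᵈ) e))
        (map-cong (λ d → val-∘ d tailᵈ (trans (val-tail (pair z x)) (tail-pair z x))) e))

    search-spec : ∀ g t x → let b = val t x ; z = val (searchᵈ g t) x in
                  (z < b → val g (pair z x) ≡ 1) × (∀ y → y < b → val g (pair y x) ≡ 1 → z < b)
    search-spec g t x = subst
      (λ z → (z < val t x → val g (pair z x) ≡ 1) ×
             (∀ y → y < val t x → val g (pair y x) ≡ 1 → z < val t x))
      (sym (val-∘-pair (μᵈ g) t idᵈ refl (val-id x))) (val-μ g (val t x) x)

    choose-spec : ∀ (t : Term n) {φ : Formula (SetConst 𝓐) (suc n)} g e x →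
                  (∀ z → Indicates (⟦ M ⟧ₛ ⊨ φ [ z ∷ at e x ]) (val g (pair z x))) →
                  ⟦ M ⟧ₛ ⊨ ∃<̇ t φ [ at e x ] →
                  ⟦ M ⟧ₛ ⊨ x₀ ≺ wkₜ t ∧̇ φ [ val (searchᵈ g (termᵈ t e)) x ∷ at e x ]
    choose-spec t g e x ind (y , y<t , φy) =
      let found , complete = search-spec g (termᵈ t e) x
          z<t = complete y (subst (y <_) t≡ y<t) (1-indicates (ind y) φy)
      in subst (val s x <_) (sym t≡) z<t , indicates-1 (ind (val s x)) (found z<t)
      where
      s = searchᵈ g (termᵈ t e)
      t≡ : ∀ {z} → ⟦ wkₜ t ⟧ (z ∷ at e x) ≡ val (termᵈ t e) x
      t≡ = trans (⟦wk⟧ t) (sym (val-term t e x))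

    indicates-ex : ∀ (t : Term n) {φ : Formula (SetConst 𝓐) (suc n)} g e x →
                   (∀ z → Indicates (⟦ M ⟧ₛ ⊨ φ [ z ∷ at e x ]) (val g (pair z x))) →
                   Indicates (⟦ M ⟧ₛ ⊨ ∃<̇ t φ [ at e x ])
                             (val (searchᵈ g (termᵈ t e) <ᵈ termᵈ t e) x)
    indicates-ex t {φ} g e x ind = indicates-map
      (λ z<t → val s x , subst (val s x <_) t≡ z<t
             , indicates-1 (ind (val s x)) (proj₁ (search-spec g (termᵈ t e) x) z<t))
      (λ ex → subst (val s x <_) (sym t≡) (proj₁ (choose-spec t {φ} g e x ind ex)))
      (val-< s (termᵈ t e) x)
      where
      s = searchᵈ g (termᵈ t e)
      t≡ : ∀ {z} → val (termᵈ t e) x ≡ ⟦ wkₜ t ⟧ (z ∷ at e x)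
      t≡ = sym (trans (⟦wk⟧ t) (sym (val-term t e x)))

    val-char : ∀ {φ : Formula (SetConst 𝓐) n} (b : Bounded φ) e x →
               Indicates (⟦ M ⟧ₛ ⊨ φ [ at e x ]) (val (charᵈ b e) x)
    val-char-under : ∀ {φ : Formula (SetConst 𝓐) (suc n)} (b : Bounded φ) e x z →
                     Indicates (⟦ M ⟧ₛ ⊨ φ [ z ∷ at e x ]) (val (charᵈ b (under e)) (pair z x))

    val-char (t ≐ u) e x =
      subst₂ (λ v w → Indicates (v ≡ w) (val (termᵈ t e ≡ᵈ termᵈ u e) x))
        (val-term t e x) (val-term u e x) (val-≡ (termᵈ t e) (termᵈ u e) x)
    val-char (t ≺ u) e x =
      subst₂ (λ v w → Indicates (v < w) (val (termᵈ t e <ᵈ termᵈ u e) x))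
        (val-term t e x) (val-term u e x) (val-< (termᵈ t e) (termᵈ u e) x)
    val-char (t ∈̇ c) e x =
      indicates-≡ (val-∘ (memberᵈ c) (termᵈ t e) (val-term t e x)) (val-member c (⟦ t ⟧ (at e x)))
    val-char ⊥̇       e x = indicates-zero id
    val-char (b ⇒ c) e x = indicates-if (charᵈ b e) (charᵈ c e) oneᵈ (val-char b e x)
      (λ φ-true → indicates-map (λ ψ-true _ → ψ-true) (λ φ⇒ψ → φ⇒ψ φ-true) (val-char c e x))
      (λ φ-false → indicates-one (⊥-elim ∘ φ-false))
    val-char (b ∧̇ c) e x = indicates-if (charᵈ b e) (charᵈ c e) zeroᵈ (val-char b e x)
      (λ φ-true → indicates-map (φ-true ,_) proj₂ (val-char c e x))
      (λ φ-false → indicates-zero (φ-false ∘ proj₁))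
    val-char (b ∨̇ c) e x = indicates-if (charᵈ b e) oneᵈ (charᵈ c e) (val-char b e x)
      (λ φ-true → indicates-one (inj₁ φ-true))
      (λ φ-false → indicates-map inj₂ (λ { (inj₁ φ-true) → contradiction φ-true φ-false
                                          ; (inj₂ ψ-true) → ψ-true }) (val-char c e x))
    val-char (all< t {φ} b) e x = indicates-map
      (λ ¬ex → decidable-stable (bounded? ⟦ M ⟧ₛ (all< t b) (at e x))
        (¬ex ∘ ¬all⇒ex¬ ⟦ M ⟧ₛ t b (at e x)))
      (λ all (z , z<t , ¬φ) → ¬φ (all z z<t))
      (indicates-not (searchᵈ g (termᵈ t e) <ᵈ termᵈ t e)
        (indicates-ex t {¬̇ φ} g e x λ z → indicates-not (charᵈ b (under e)) (val-char-under b e x z)))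
      where g = notᵈ (charᵈ b (under e))
    val-char (ex< t {φ} b) e x = indicates-ex t {φ} (charᵈ b (under e)) e x (val-char-under b e x)

    val-char-under {φ = φ} b e x z = 
      subst (λ ρ → Indicates (⟦ M ⟧ₛ ⊨ φ [ ρ ]) (val (charᵈ b (under e)) (pair z x))) (at-under e z x)
      (val-char b (under e) (pair z x))

-- Extracting a derivation from a proof

record Point (𝓐 : AlgebraClass) : Set where
  constructor point
  field
    {oracleSet} : Subset
    model    : StandardModel 𝓐 oracleSet
    argument : ℕ

open Point

module _ {𝓐 : AlgebraClass} where
  open Algebra 𝓐
  open Values

  -- A condition is settled if one derivation computes a witness for φ at all of
  -- its points.  Witnesses on two parts separated by a bounded formula are glued
  -- by the conditional, with the characteristic function of the formula as test.
  herbrandFrame : Formula (SetConst 𝓐) 2 → Frame 𝓐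
  herbrandFrame φ = record
    { World     = Point 𝓐
    ; Name      = Derivation 𝓐
    ; oracleAt  = oracleSet
    ; modelAt   = model
    ; value     = λ { d (point M x) → val M d x }
    ; Settled   = Witnessed
    ; settled-⊆ = λ q⊆p (d , h) → d , h ∘ q⊆p
    ; settled-∅ = idᵈ , λ ()
    ; split     = split
    ; termName  = λ t e → termᵈ t e , λ { (point M x) → val-term M t e x }
    ; imageName = λ d a → d ∘ᵈ a , λ { (point M x) →
        subst (λ y → sets M d (pair (val M a x) y) ≡ true) (sym (val-∘ M d a refl)) (val-∈ M d (val M a x)) }
    ; choose    = λ t {ψ} b e → searchᵈ (charᵈ b (under e)) (termᵈ t e) ,
        λ { {point M x} → choose-spec M t {ψ} (charᵈ b (under e)) e x (val-char-under M b e x) }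
    }
    where
    Witnessed : (Point 𝓐 → Set) → Set
    Witnessed p = ∃ λ d → ∀ {w} → p w →
                  ⟦ model w ⟧ₛ ⊨ φ [ val (model w) d (argument w) ∷ argument w ∷ [] ]

    split : ∀ {ψ : Formula (SetConst 𝓐) n} → Bounded ψ → ∀ e {p} →
            let A = λ w → ⟦ model w ⟧ₛ ⊨ ψ [ at (model w) e (argument w) ] in
            Witnessed (p ∩ A) → Witnessed (p ∩ ∁ A) → Witnessed p
    split b e {p} (d , h) (d' , h') = ifᵈ (charᵈ b e) d d' , λ { {point M x} → by-cases M x }
      where
      by-cases : ∀ {O} (M : StandardModel 𝓐 O) x → p (point M x) →
                 ⟦ M ⟧ₛ ⊨ φ [ val M (ifᵈ (charᵈ b e) d d') x ∷ x ∷ [] ]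
      by-cases M x w∈p =
        [ (λ (ψ-true , c≡1) → realize (val-if-1 M (charᵈ b e) d d' c≡1) (h (w∈p , ψ-true)))
        , (λ (ψ-false , c≡0) → realize (val-if-0 M (charᵈ b e) d d' c≡0) (h' (w∈p , ψ-false)))
        ]′ (val-char M b e x)
        where
        realize : ∀ {v w} → v ≡ w → ⟦ M ⟧ₛ ⊨ φ [ w ∷ x ∷ [] ] → ⟦ M ⟧ₛ ⊨ φ [ v ∷ x ∷ [] ]
        realize refl = id

  -- The name of x is the identity.  Once a name a is forced to satisfy φ(x , a),
  -- the derivation a is itself the witness wherever φ(x , a) is true.
  herbrand : ∀ {φ} → Σ⁰₁ φ → RA₁ 𝓐 ∣ [] ⊢ ∀̇ ∃!̇ φ →
             ∃ λ d → ∀ {O} (M : StandardModel 𝓐 O) x → ⟦ M ⟧ₛ ⊨ φ [ val M d x ∷ x ∷ [] ]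
  herbrand {φ} σ ⊢∃! =
    let d , h = theorem-forced ⊢∃! (λ _ → ⊤) idᵈ (λ _ → ⊤) id λ r _ a (r⊩φ , _) →
          Σ⁻ σ r⊩φ λ q _ q⊆φ → a , λ { {point M x} w∈q →
            subst (λ v → ⟦ M ⟧ₛ ⊨ φ [ val M a x ∷ v ∷ [] ]) (val-id M x) (q⊆φ w∈q) }
    in d , λ M x → h {point M x} tt
    where open Forcing (herbrandFrame φ)

  ⊢graph-functional : ∀ (d : Derivation 𝓐) → RA₁ 𝓐 ∣ [] ⊢ ∀̇ ∃!̇ (𝐟 d ⟨ x₁ {0} ⟩≐ x₀)
  ⊢graph-functional d =
    ∀I (∃E (∀E (∧E₁ (axiom (total d))) x₀)
      (∃I x₀ (∧I (assume (here refl))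
        (∀I (⇒I (⇒E (∀E (∀E (∀E (∧E₁ (∧E₂ (axiom (total d)))) x₁) x₀) x₂)
          (∧I (assume (here refl)) (assume (there (here refl))))))))))

theorem8p3 : (𝓐 : AlgebraClass) (F : ℕ × Subset → ℕ) → ProvablyTotal 𝓐 F ⇔ ∃ λ (d : Derivation 𝓐) → Derives 𝓐 d F
theorem8p3 𝓐 F = mk⇔ derive prove
  where
  open Algebra 𝓐
  open Values

  derive : ProvablyTotal 𝓐 F → ∃ λ d → Derives 𝓐 d F
  derive record { formula = φ ; isΣ⁰₁ = σ ; provable = ⊢∃! ; defines = defines } =
    let d , h = herbrand σ ⊢∃!
    in d , λ O M x → subst (λ y → sets M d (pair x y) ≡ true)
                       (provably-unique M σ ⊢∃! (h M x) (defines O M x)) (val-∈ M d x)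

  prove : (∃ λ d → Derives 𝓐 d F) → ProvablyTotal 𝓐 F
  prove (d , derives) = record
    { formula  = 𝐟 d ⟨ x₁ ⟩≐ x₀
    ; isΣ⁰₁    = bounded (⟪ x₁ , x₀ ⟫ ∈̇ 𝐟 d)
    ; provable = ⊢graph-functional d
    ; defines  = derives
    }
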